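{- As $r \to \infty$, \[ f(r, C_6) \leq 2 r^{1/2} + o(r^{1/2}) \quad \text{and} \quad f(r, C_{10}) \leq 2 r^{2/3} + o(r^{2/3}). \]
   Context: Let $r,k$ be positive integers. A graph $G$ is an $(r,k)$-graph if $V(G)$ can be partitioned into sets $V_1,\dots,V_r$ with $|V_i| \le k$ for all $i$ such that for every pair $i \neq j$ in $[r]$ there is an edge of $G$ with one endpoint in $V_i$ and the other in $V_j$. For a graph $H$, $f(r,H)$ is the minimum $k$ such that there exists an $H$-free $(r,k)$-graph. $C_\ell$ denotes the cycle of length $\ell$. $o(g(r))$ denotes a quantity $h(r)$ with $h(r)/g(r)\to 0$ as $r\to\infty$. -}

module Defs where

open import Level using (0ℓ)
open import Data.Nat using (ℕ; zero; suc; _*_; _^_; _≤_)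
open import Data.Fin using (Fin; toℕ; fromℕ) renaming (zero to fzero; _≟_ to _≟ᶠ_)
open import Data.List using (List; length; filter; allFin)
open import Data.Product using (Σ; ∃; ∃-syntax; _×_)
open import Relation.Binary.PropositionalEquality using (_≡_; _≢_)
open import Relation.Nullary using (¬_)
open import Function.Definitions using (Injective)

record Graph (n : ℕ) : Set₁ where
  field
    Adj   : Fin n → Fin n → Set
    sym   : ∀ {u v} → Adj u v → Adj v u
    irrefl : ∀ {v} → ¬ Adj v v
open Graph public

ContainsCycle : ∀ {n} → Graph n → ℕ → Set
ContainsCycle {n} G zero = Fin zero → Fin zero
ContainsCycle {n} G (suc m) =
  Σ (Fin (suc m) → Fin n) λ c →
    Injective _≡_ _≡_ c ×
    (∀ i j → suc (toℕ i) ≡ toℕ j → Adj G (c i) (c j)) ×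
    Adj G (c (fromℕ m)) (c fzero)

partSize : ∀ {n r} → (Fin n → Fin r) → Fin r → ℕ
partSize {n} part i = length (filter (λ v → part v ≟ᶠ i) (allFin n))

IsRKGraph : ∀ {n} → Graph n → ℕ → ℕ → Set
IsRKGraph {n} G r k =
  Σ (Fin n → Fin r) λ part →
    (∀ i → partSize part i ≤ k) ×
    (∀ i j → i ≢ j → ∃[ u ] ∃[ v ] (part u ≡ i × part v ≡ j × Adj G u v))

ExistsFreeRK : ℕ → ℕ → ℕ → Set₁
ExistsFreeRK ℓ r k =
  ∃[ n ] Σ (Graph n) λ G → IsRKGraph G r k × ¬ ContainsCycle G ℓ

-- f(r, C_ℓ) ≤ x  ⇔  some k ≤ x admits a C_ℓ-free (r,k)-graph (f is a minimum).

{-# OPTIONS --safe #-}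
module Submission where

-- Fix a prime q. In Wenger's graph the points and lines have 2h + 1 coordinates modulo q, and around a closed
-- walk of length 4h + 2 the steps, multiples of moment vectors (1, x, …, x^{2h}), sum to zero; as 2h + 1 such
-- vectors at distinct nodes are independent, there is no such cycle for h = 1 and h = 2. Fixing h + 1 coordinates
-- of the points and a complementary choice of h + 1 coordinates of the lines yields q^{h+1} parts of q^h points and
-- q^{h+1} parts of q^h lines with an edge between any point part and any line part.
--
-- Uniting point parts with line parts handles r = q^{h+1} with k = 2 q^h. In order to avoid the prime number theorem,
-- r = q^{h+1} + x with x ≤ q^{h+1} is reduced to x: the first x parts get only points, the last x parts only lines,
-- and each of these two families is completed by a copy of the graph for x. Since the two families have room
-- to spare, this preserves the bound 2 r^{h/(h+1)} + O(1) as long as q ≥ (4/5) r^{1/(h+1)}.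
--
-- Chebyshev's integers (30n)! n! / ((15n)! (10n)! (6n)!) give primes in all intervals of ratio above 6/5,
-- in particular of ratio 5/4.

open import Defs
open import Data.Nat
open import Data.Nat.Properties
open import Data.Nat.Divisibility using (_∣_; divides; _∣?_; ∣⇒≤; ∣1⇒≡1; 1∣_; n∣m*n; ∣n⇒∣m*n; *-cancelˡ-∣; *-monoʳ-∣)
import Data.Nat.Divisibility as ℕ
open import Data.Nat.DivMod
open import Data.Nat.Primality
open import Data.Nat.Primality.Factorisation using (factorise)
open import Data.Nat.Coprimality using (Coprime; coprime-divisor)
open import Data.Nat.Induction using (<-rec)
open import Data.Nat.Tactic.RingSolver using (solve-∀)
open import Data.Integer using (ℤ; 0ℤ; 1ℤ) renaming (+_ to infix 8 ⁺_)
import Data.Integer as ℤ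
import Data.Integer.Properties as ℤ
import Data.Integer.Divisibility.Signed as ℤ
import Data.Integer.DivMod as ℤ using (n%ℕd<d; a≡a%ℕn+[a/ℕn]*n)
import Data.Integer.Tactic.RingSolver as ℤSolver
open import Data.Bool using (Bool; true; false; T; _∧_)
open import Data.Bool.Properties using (T-∧)
open import Data.Fin using (Fin; toℕ; fromℕ<; combine; remQuot; quotient; funToFin; finToFun)
  renaming (zero to fzero; suc to fsuc; _≟_ to _≟ᶠ_)
import Data.Fin.Properties as Fin
open import Data.List using (List; []; _∷_; lookup; filter; allFin)
import Data.List.Relation.Unary.All as All
open import Data.List.Relation.Unary.All.Properties using (all-filter)
open import Data.List.Relation.Unary.AllPairs using (_∷_)
open import Data.List.Relation.Unary.Unique.Propositional using (Unique)
open import Data.List.Relation.Unary.Unique.Propositional.Properties using (allFin⁺; filter⁺)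
open import Data.List.Membership.Propositional.Properties using (∈-lookup)
open import Data.Product using (Σ; ∃-syntax; _×_; _,_; proj₁; proj₂)
open import Data.Sum as Sum using (_⊎_; inj₁; inj₂)
open import Data.Sum.Properties using (inj₁-injective; inj₂-injective)
open import Data.Empty using (⊥; ⊥-elim)
open import Data.Unit using (tt)
open import Function using (_∘_)
open import Function.Bundles using (Equivalence)
open import Relation.Binary using (tri<; tri≈; tri>)
open import Relation.Binary.PropositionalEquality hiding (sym)
import Relation.Binary.PropositionalEquality as Eq
open import Relation.Nullary using (¬_; Dec; yes; no; contradiction)
open import Relation.Nullary.Decidable using (from-yes; True; toWitness; _×-dec_)

-- Prime factorisation of factorials

-- Around a closed walk the directions of the lines need not be distinct, so independence does not
-- exclude the walk at once. It shows only that the direction of every line recurs on another line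
-- of the walk, while consecutive lines have different directions. The classes of equal direction
-- therefore split a cycle of 2h + 1 lines into independent sets of size at least 2. On 3 or 5 lines
-- some class would have at least 3 members, too many for an independent set; on 7 lines the pattern
-- a b a c b a c survives, so the argument stops at h = 2. Rounding r^{1/(h+1)} up to a prime would
-- cost a constant factor unless prime gaps are known to be short; hence the recursion on the
-- remainder x. It still needs a prime not too far below. For h = 1 and j = 2 √x the inequality (q +
-- j)² ≤ 4 (q² + x) says √x ≤ (3/4) q, that is q ≥ (4/5) √r. So the ratio 5/4 is forced there and
-- Bertrand's postulate would not do.

*-interchange : ∀ a b c d → (a * b) * (c * d) ≡ (a * c) * (b * d)
*-interchange = solve-∀

prod : (ℕ → ℕ) → ℕ → ℕ
prod f zero = 1
prod f (suc n) = prod f n * f n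

prod-cong : ∀ {f g} n → (∀ i → i < n → f i ≡ g i) → prod f n ≡ prod g n
prod-cong zero eq = refl
prod-cong (suc n) eq =
  cong₂ _*_ (prod-cong n λ i i<n → eq i (m<n⇒m<1+n i<n)) (eq n ≤-refl)

prod-mono : ∀ {f g} n → (∀ i → i < n → f i ≤ g i) → prod f n ≤ prod g n
prod-mono zero le = ≤-refl
prod-mono (suc n) le =
  *-mono-≤ (prod-mono n λ i i<n → le i (m<n⇒m<1+n i<n)) (le n ≤-refl)

prod-* : ∀ f g n → prod f n * prod g n ≡ prod (λ i → f i * g i) n
prod-* f g zero = refl
prod-* f g (suc n) = begin
  (prod f n * f n) * (prod g n * g n) ≡⟨ *-interchange (prod f n) (f n) (prod g n) (g n) ⟩
  (prod f n * prod g n) * (f n * g n) ≡⟨ cong (_* (f n * g n)) (prod-* f g n) ⟩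
  prod (λ i → f i * g i) n * (f n * g n) ∎
  where open ≡-Reasoning

prod-1 : ∀ {f} n → (∀ i → i < n → f i ≡ 1) → prod f n ≡ 1
prod-1 zero eq = refl
prod-1 (suc n) eq = cong₂ _*_ (prod-1 n λ i i<n → eq i (m<n⇒m<1+n i<n)) (eq n ≤-refl)

prod-single : ∀ {f} n j → j < n → (∀ i → i ≢ j → f i ≡ 1) → prod f n ≡ f j
prod-single {f} (suc n) j (s≤s j≤n) eq with n ≟ j
... | yes refl = trans (cong (_* f n) (prod-1 n λ i i<n → eq i (<⇒≢ i<n))) (*-identityˡ (f n))
... | no n≢j = trans (cong₂ _*_ (prod-single n j (≤∧≢⇒< j≤n λ j≡n → n≢j (Eq.sym j≡n)) eq) (eq n n≢j))
                     (*-identityʳ (f j))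

sum : (ℕ → ℕ) → ℕ → ℕ
sum f zero = 0
sum f (suc n) = sum f n + f n

sum-cong : ∀ {f g} n → (∀ i → f i ≡ g i) → sum f n ≡ sum g n
sum-cong zero eq = refl
sum-cong (suc n) eq = cong₂ _+_ (sum-cong n eq) (eq n)

sum-0 : ∀ {f} n → (∀ i → f i ≡ 0) → sum f n ≡ 0
sum-0 zero eq = refl
sum-0 (suc n) eq = cong₂ _+_ (sum-0 n eq) (eq n)

sum-shift : ∀ f n → sum f (suc n) ≡ f 0 + sum (λ i → f (suc i)) n
sum-shift f zero = Eq.sym (+-identityʳ (f 0))
sum-shift f (suc n) = trans (cong (_+ f (suc n)) (sum-shift f n)) (+-assoc (f 0) _ _)

sum-+ : ∀ f g n → sum f n + sum g n ≡ sum (λ i → f i + g i) n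
sum-+ f g zero = refl
sum-+ f g (suc n) = trans (lemma (sum f n) (f n) (sum g n) (g n)) (cong (_+ (f n + g n)) (sum-+ f g n))
  where
  lemma : ∀ a b c d → (a + b) + (c + d) ≡ (a + c) + (b + d)
  lemma = solve-∀

indicator : ∀ {P : Set} → Dec P → ℕ
indicator (yes _) = 1
indicator (no _) = 0

indicator-cong : ∀ {P Q : Set} (p : Dec P) (q : Dec Q) → (P → Q) → (Q → P) → indicator p ≡ indicator q
indicator-cong (yes _) (yes _) f g = refl
indicator-cong (yes p) (no ¬q) f g = ⊥-elim (¬q (f p))
indicator-cong (no ¬p) (yes q) f g = ⊥-elim (¬p (g q))
indicator-cong (no _) (no _) f g = refl

indicator≤1 : ∀ {P : Set} (p : Dec P) → indicator p ≤ 1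
indicator≤1 (yes _) = ≤-refl
indicator≤1 (no _) = z≤n

indicator-yes : ∀ {P : Set} (p : Dec P) → P → indicator p ≡ 1
indicator-yes (yes _) _ = refl
indicator-yes (no ¬p) p = ⊥-elim (¬p p)

indicator-no : ∀ {P : Set} (p : Dec P) → ¬ P → indicator p ≡ 0
indicator-no (yes p) ¬p = ⊥-elim (¬p p)
indicator-no (no _) _ = refl

-- The factor a prime p with exponent e contributes; it is 1 when p is not prime.
primePower : ℕ → ℕ → ℕ
primePower p e = p ^ (indicator (prime? p) * e)

primePower-prime : ∀ {p} e → Prime p → primePower p e ≡ p ^ e
primePower-prime {p} e pp rewrite indicator-yes (prime? p) pp = cong (p ^_) (+-identityʳ e)

primePower-0 : ∀ p → primePower p 0 ≡ 1
primePower-0 p = cong (p ^_) (*-zeroʳ (indicator (prime? p)))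

primePower-+ : ∀ p e f → primePower p (e + f) ≡ primePower p e * primePower p f
primePower-+ p e f =
  trans (cong (p ^_) (*-distribˡ-+ (indicator (prime? p)) e f)) (^-distribˡ-+-* p (indicator (prime? p) * e) _)

primePower-cong : ∀ p {e f} → (Prime p → e ≡ f) → primePower p e ≡ primePower p f
primePower-cong p {e} {f} eq with prime? p
... | yes pp = cong (λ x → p ^ (1 * x)) (eq pp)
... | no _ = refl

primePower-mono : ∀ p {e f} → (Prime p → p ^ e ≤ f) → 1 ≤ f → primePower p e ≤ f
primePower-mono p {e} {f} le 1≤f with prime? p
... | yes pp = subst (λ x → p ^ x ≤ f) (Eq.sym (+-identityʳ e)) (le pp)
... | no _ = 1≤f

prime⇒2≤ : ∀ {p} → Prime p → 2 ≤ p
prime⇒2≤ {p} pp = nonTrivial⇒n>1 p {{prime⇒nonTrivial pp}}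

n<2^n : ∀ n → n < 2 ^ n
n<2^n zero = s≤s z≤n
n<2^n (suc n) = begin-strict
  suc n ≡⟨ +-comm 1 n ⟩
  n + 1 ≤⟨ +-monoʳ-≤ n (m^n>0 2 n) ⟩
  n + 2 ^ n <⟨ +-monoˡ-< (2 ^ n) (n<2^n n) ⟩
  2 ^ n + 2 ^ n ≡⟨ cong (2 ^ n +_) (+-identityʳ (2 ^ n)) ⟨
  2 ^ suc n ∎
  where open ≤-Reasoning

n<p^n : ∀ {p} n → 2 ≤ p → n < p ^ n
n<p^n n 2≤p = <-≤-trans (n<2^n n) (^-monoˡ-≤ n 2≤p)

-- The p-adic valuation of m, as long as m < p ^ suc K.
valuation : ℕ → ℕ → ℕ → ℕ
valuation K p m = sum (λ k → indicator (p ^ suc k ∣? m)) K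

coprime-prime-power : ∀ {p q} k → Prime p → Prime q → p ≢ q → Coprime (q ^ k) p
coprime-prime-power {p} {q} k pp pq p≢q (d∣q^k , d∣p) with prime⇒irreducible pp d∣p
... | inj₁ d≡1 = d≡1
... | inj₂ refl = ⊥-elim (p≢q (p∣q^k⇒p≡q k d∣q^k))
  where
  p∣q^k⇒p≡q : ∀ k → p ∣ q ^ k → p ≡ q
  p∣q^k⇒p≡q zero p∣1 = ⊥-elim (<⇒≢ (prime⇒2≤ pp) (Eq.sym (∣1⇒≡1 p∣1)))
  p∣q^k⇒p≡q (suc k) p∣ with euclidsLemma q (q ^ k) pp p∣
  ... | inj₂ p∣q^k = p∣q^k⇒p≡q k p∣q^k
  ... | inj₁ p∣q with prime⇒irreducible pq p∣q
  ...   | inj₁ p≡1 = ⊥-elim (<⇒≢ (prime⇒2≤ pp) (Eq.sym p≡1))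
  ...   | inj₂ p≡q = p≡q

valuation-≢ : ∀ K {p q} m → Prime p → Prime q → p ≢ q → valuation K q (p * m) ≡ valuation K q m
valuation-≢ K {p} {q} m pp pq p≢q = sum-cong K λ k →
  indicator-cong (q ^ suc k ∣? p * m) (q ^ suc k ∣? m)
    (coprime-divisor (coprime-prime-power (suc k) pp pq p≢q)) (∣n⇒∣m*n p)

-- Cancelling p moves every index down by one: the sum gains the term for 1 ∣ m, which is 1, and
-- loses the term for `p ^ suc K` ∣ m, which is 0 because m is too small.
valuation-≡ : ∀ K {p} m .{{_ : NonZero m}} → Prime p → m < p ^ suc K →
  valuation (suc K) p (p * m) ≡ suc (valuation (suc K) p m)
valuation-≡ K {p} m pp m< = begin
  sum (λ k → indicator (p ^ suc k ∣? p * m)) (suc K)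
    ≡⟨ sum-cong (suc K) (λ k → indicator-cong (p ^ suc k ∣? p * m) (p ^ k ∣? m) (*-cancelˡ-∣ p) (*-monoʳ-∣ p)) ⟩
  sum (λ k → indicator (p ^ k ∣? m)) (suc K)
    ≡⟨ sum-shift (λ k → indicator (p ^ k ∣? m)) K ⟩
  indicator (1 ∣? m) + valuation K p m
    ≡⟨ cong (_+ valuation K p m) (indicator-yes (1 ∣? m) (1∣ m)) ⟩
  suc (valuation K p m)
    ≡⟨ cong suc (+-identityʳ _) ⟨
  suc (valuation K p m + 0)
    ≡⟨ cong (λ x → suc (valuation K p m + x)) (indicator-no (p ^ suc K ∣? m) λ d → <⇒≱ m< (∣⇒≤ d)) ⟨
  suc (valuation (suc K) p m) ∎
  where
  open ≡-Reasoning
  instance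
    p≢0 : NonZero p
    p≢0 = prime⇒nonZero pp

prime-divisor : ∀ n → 2 ≤ n → ∃[ p ] ∃[ m ] (Prime p × n ≡ p * m)
prime-divisor n@(suc _) 2≤n with factorise n
... | record { factors = [] ; isFactorisation = n≡1 } = ⊥-elim (<⇒≢ 2≤n (Eq.sym n≡1))
... | record { factors = p ∷ ps ; isFactorisation = eq ; factorsPrime = pp All.∷ _ } = p , _ , pp , eq

-- Strong induction that splits off one prime divisor p: the valuation at p grows by one and those
-- at other primes stay. Summing over `suc K` powers is enough because m ≤ `suc K` < p ^ `suc K`.
prod-valuation : ∀ K N m .{{_ : NonZero m}} → m ≤ suc K → m < N →
  prod (λ p → primePower p (valuation (suc K) p m)) N ≡ m
prod-valuation K N m = <-rec
  (λ m → .{{_ : NonZero m}} → m ≤ suc K → m < N →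
    prod (λ p → primePower p (valuation (suc K) p m)) N ≡ m)
  step m
  where
  step : ∀ m → (∀ {j} → j < m → .{{_ : NonZero j}} → j ≤ suc K → j < N →
      prod (λ p → primePower p (valuation (suc K) p j)) N ≡ j) →
    .{{_ : NonZero m}} → m ≤ suc K → m < N →
    prod (λ p → primePower p (valuation (suc K) p m)) N ≡ m
  step 1 rec m≤K m<N = prod-1 N λ p _ → begin
    primePower p (valuation (suc K) p 1)
      ≡⟨ primePower-cong p (λ pp → sum-0 (suc K) λ k → indicator-no (p ^ suc k ∣? 1) λ d →
           <⇒≱ (<-≤-trans (s≤s (s≤s z≤n)) (n<p^n (suc k) (prime⇒2≤ pp))) (∣⇒≤ d)) ⟩
    primePower p 0 ≡⟨ primePower-0 p ⟩
    1 ∎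
    where open ≡-Reasoning
  step m@(suc (suc _)) rec m≤K m<N with prime-divisor m (s≤s (s≤s z≤n))
  ... | p , zero , pp , eq = contradiction (trans eq (*-zeroʳ p)) λ ()
  ... | p , j@(suc _) , pp , eq = begin
    prod (λ q → primePower q (valuation (suc K) q m)) N
      ≡⟨ prod-cong N (λ q _ → trans (primePower-cong q (val q)) (primePower-+ q _ _)) ⟩
    prod (λ q → primePower q (indicator (q ≟ p)) * primePower q (valuation (suc K) q j)) N
      ≡⟨ prod-* _ _ N ⟨
    prod (λ q → primePower q (indicator (q ≟ p))) N * prod (λ q → primePower q (valuation (suc K) q j)) N
      ≡⟨ cong₂ _*_ (prod-single N p p<N λ q q≢p →
           trans (cong (primePower q) (indicator-no (q ≟ p) q≢p)) (primePower-0 q))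
           (rec j<m (≤-trans (<⇒≤ j<m) m≤K) (<-trans j<m m<N)) ⟩
    primePower p (indicator (p ≟ p)) * j
      ≡⟨ cong (_* j) (trans (cong (primePower p) (indicator-yes (p ≟ p) refl)) (primePower-prime 1 pp)) ⟩
    p ^ 1 * j ≡⟨ cong (_* j) (^-identityʳ p) ⟩
    p * j ≡⟨ eq ⟨
    m ∎
    where
    open ≡-Reasoning
    p<N : p < N
    p<N = ≤-<-trans (subst (p ≤_) (Eq.sym eq) (m≤m*n p j)) m<N
    j<m : j < m
    j<m = subst (j <_) (trans (*-comm j p) (Eq.sym eq)) (m<m*n j p (prime⇒2≤ pp))
    val : ∀ q → Prime q → valuation (suc K) q m ≡ indicator (q ≟ p) + valuation (suc K) q j
    val q pq with q ≟ p
    ... | yes refl = trans (cong (valuation (suc K) q) eq)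
      (valuation-≡ K j pq (<-trans (<-≤-trans j<m m≤K) (n<p^n (suc K) (prime⇒2≤ pq))))
    ... | no q≢p = trans (cong (valuation (suc K) q) eq) (valuation-≢ (suc K) j pp pq λ p≡q → q≢p (Eq.sym p≡q))

multiples : ℕ → ℕ → ℕ
multiples d n = sum (λ m → indicator (d ∣? suc m)) n

multiples≡/ : ∀ d n .{{_ : NonZero d}} → multiples d n ≡ n / d
multiples≡/ d zero = Eq.sym (0/n≡0 d)
multiples≡/ d (suc n) with d ∣? suc n
... | no d∤ = trans (+-identityʳ _) (trans (multiples≡/ d n) (Eq.sym eq))
  where
  open ≡-Reasoning
  r = n % d
  r+1<d : suc r < d
  r+1<d = ≤∧≢⇒< (m%n<n n d) λ r+1≡d → d∤ (divides (suc (n / d))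
    (trans (cong suc (m≡m%n+[m/n]*n n d)) (cong (_+ n / d * d) r+1≡d)))
  eq : suc n / d ≡ n / d
  eq = begin
    suc n / d ≡⟨ cong (λ x → suc x / d) (m≡m%n+[m/n]*n n d) ⟩
    (suc r + n / d * d) / d ≡⟨ +-distrib-/-∣ʳ (suc r) (n∣m*n (n / d)) ⟩
    suc r / d + n / d * d / d ≡⟨ cong₂ _+_ (m<n⇒m/n≡0 r+1<d) (m*n/n≡m (n / d) d) ⟩
    n / d ∎
... | yes (divides (suc q) eq) = trans (cong (_+ 1) (trans (multiples≡/ d n) n/d≡q)) (trans (+-comm q 1) (Eq.sym n+1/d))
  where
  open ≡-Reasoning
  n+1/d : suc n / d ≡ suc q
  n+1/d = trans (cong (_/ d) eq) (m*n/n≡m (suc q) d)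
  n/d≡q : n / d ≡ q
  n/d≡q = ≤-antisym (s≤s⁻¹ (m<n*o⇒m/o<n (≤-reflexive eq)))
    (subst (_≤ n / d) (m*n/n≡m q d) (/-monoˡ-≤ d (+-cancelˡ-≤ 1 _ _
      (subst (suc (q * d) ≤_) (Eq.sym eq) (+-monoˡ-≤ (q * d) (>-nonZero⁻¹ d))))))

-- The ranges N and `suc K` are kept apart from n so that the five factorials of the Chebyshev ratio
-- can be factored over the same primes and powers and then compared factor by factor.
legendre : ∀ K N n → n ≤ suc K → n < N →
  prod (λ p → primePower p (sum (λ k → multiples (p ^ suc k) n) (suc K))) N ≡ n !
legendre K N zero n≤K n<N = prod-1 N λ p _ →
  trans (cong (primePower p) (sum-0 (suc K) λ _ → refl)) (primePower-0 p)
legendre K N (suc n) n≤K n<N = begin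
  prod (λ p → primePower p (sum (λ k → multiples (p ^ suc k) (suc n)) (suc K))) N
    ≡⟨ prod-cong N (λ p _ → trans (cong (primePower p) (Eq.sym (sum-+ _ _ (suc K)))) (primePower-+ p _ _)) ⟩
  prod (λ p → primePower p (sum (λ k → multiples (p ^ suc k) n) (suc K)) * primePower p (valuation (suc K) p (suc n))) N
    ≡⟨ prod-* _ _ N ⟨
  prod (λ p → primePower p (sum (λ k → multiples (p ^ suc k) n) (suc K))) N
    * prod (λ p → primePower p (valuation (suc K) p (suc n))) N
    ≡⟨ cong₂ _*_ (legendre K N n (<⇒≤ n≤K) (<-trans (n<1+n n) n<N)) (prod-valuation K N (suc n) n≤K n<N) ⟩
  n ! * suc n ≡⟨ *-comm (n !) (suc n) ⟩
  suc n * n ! ∎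
  where open ≡-Reasoning

-- φ ⌊x⌋ = ⌊x⌋ - ⌊x/2⌋ - ⌊x/3⌋ - ⌊x/5⌋ + ⌊x/30⌋, which has period 30.
φ₃₀ : ℕ → ℕ
φ₃₀ b = b ∸ (b / 2 + b / 3 + b / 5)

φ : ℕ → ℕ
φ e = φ₃₀ (e % 30)

φ≤1 : ∀ e → φ e ≤ 1
φ≤1 e = from-yes (allUpTo? (λ b → φ₃₀ b ≤? 1) 30) (m%n<n e 30)

φ-small : ∀ e → 1 ≤ e → e < 6 → φ e ≡ 1
φ-small (suc e) _ (s≤s e<5) = from-yes (allUpTo? (λ b → φ (suc b) ≟ 1) 5) e<5

-- Adding 30 to e adds 30 + 1 on the left and 15 + 10 + 6 on the right, so only residues modulo 30
-- have to be inspected.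
φ-identity : ∀ e → e + e / 30 ≡ φ e + (e / 2 + e / 3 + e / 5)
φ-identity e = begin
  e + a ≡⟨ cong (_+ a) (trans (m≡m%n+[m/n]*n e 30) (cong (_+ a * 30) b-eq)) ⟩
  (φ₃₀ b + (b / 2 + b / 3 + b / 5)) + a * 30 + a
    ≡⟨ regroup (φ₃₀ b) (b / 2) (b / 3) (b / 5) a ⟩
  φ₃₀ b + ((b / 2 + a * 15) + (b / 3 + a * 10) + (b / 5 + a * 6))
    ≡⟨ cong (φ₃₀ b +_) (cong₂ _+_ (cong₂ _+_ (quot 2 15 refl) (quot 3 10 refl)) (quot 5 6 refl)) ⟨
  φ e + (e / 2 + e / 3 + e / 5) ∎
  where
  open ≡-Reasoning
  a = e / 30
  b = e % 30
  -- This check of 30 residues also shows that the truncated subtraction in `φ₃₀` never cuts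
  -- anything off.
  b-eq : b ≡ φ₃₀ b + (b / 2 + b / 3 + b / 5)
  b-eq = from-yes (allUpTo? (λ b → b ≟ φ₃₀ b + (b / 2 + b / 3 + b / 5)) 30) (m%n<n e 30)
  regroup : ∀ f x y z a → (f + (x + y + z)) + a * 30 + a ≡ f + ((x + a * 15) + (y + a * 10) + (z + a * 6))
  regroup = solve-∀
  quot : ∀ k j .{{_ : NonZero k}} → j * k ≡ 30 → e / k ≡ b / k + a * j
  quot k j jk = begin
    e / k ≡⟨ cong (_/ k) (trans (m≡m%n+[m/n]*n e 30) (cong (λ x → b + a * x) (Eq.sym jk))) ⟩
    (b + a * (j * k)) / k ≡⟨ cong (λ x → (b + x) / k) (*-assoc a j k) ⟨
    (b + a * j * k) / k ≡⟨ +-distrib-/-∣ʳ b (n∣m*n (a * j)) ⟩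
    b / k + a * j * k / k ≡⟨ cong (b / k +_) (m*n/n≡m (a * j) k) ⟩
    b / k + a * j ∎

multiples-scale : ∀ d k n .{{_ : NonZero d}} .{{_ : NonZero k}} →
  multiples d n ≡ multiples d (k * n) / k
multiples-scale d k n = begin
  multiples d n ≡⟨ multiples≡/ d n ⟩
  n / d ≡⟨ m*n/m*o≡n/o k n d ⟨
  k * n / (k * d) ≡⟨ /-congʳ (*-comm k d) ⟩
  k * n / (d * k) ≡⟨ m/n/o≡m/[n*o] (k * n) d k ⟨
  k * n / d / k ≡⟨ cong (_/ k) (multiples≡/ d (k * n)) ⟨
  multiples d (k * n) / k ∎
  where
  open ≡-Reasoning
  instance
    kd : NonZero (k * d)
    kd = m*n≢0 k d
    dk : NonZero (d * k)
    dk = m*n≢0 d k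

multiples-identity : ∀ d n .{{_ : NonZero d}} →
  multiples d (30 * n) + multiples d n ≡
    φ (multiples d (30 * n)) + (multiples d (15 * n) + multiples d (10 * n) + multiples d (6 * n))
multiples-identity d n = begin
  e + multiples d n ≡⟨ cong (e +_) (multiples-scale d 30 n) ⟩
  e + e / 30 ≡⟨ φ-identity e ⟩
  φ e + (e / 2 + e / 3 + e / 5)
    ≡⟨ cong (φ e +_) (cong₂ _+_ (cong₂ _+_ (part 2 15 refl) (part 3 10 refl)) (part 5 6 refl)) ⟨
  φ e + (multiples d (15 * n) + multiples d (10 * n) + multiples d (6 * n)) ∎
  where
  open ≡-Reasoning
  e = multiples d (30 * n)
  part : ∀ k j .{{_ : NonZero k}} → k * j ≡ 30 → multiples d (j * n) ≡ e / k
  part k j eq = trans (multiples-scale d k (j * n))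
    (cong (λ x → multiples d x / k) (trans (Eq.sym (*-assoc k j n)) (cong (_* n) eq)))

-- For K ≥ 30 n this is the exponent of the prime p in (30n)! n! / ((15n)! (10n)! (6n)!).
ratioExponent : ℕ → ℕ → ℕ → ℕ
ratioExponent K n p = sum (λ k → φ (multiples (p ^ suc k) (30 * n))) K

chebyshevRatio : ℕ → ℕ
chebyshevRatio n = prod (λ p → primePower p (ratioExponent (suc (30 * n)) n p)) (suc (30 * n))

chebyshev-factorials : ∀ n →
  (30 * n) ! * n ! ≡ chebyshevRatio n * ((15 * n) ! * (10 * n) ! * (6 * n) !)
chebyshev-factorials n = begin
  (30 * n) ! * n ! ≡⟨ cong₂ _*_ (leg (30 * n) ≤-refl) (leg n (m≤n*m n 30)) ⟩
  prod (V (30 * n)) N * prod (V n) N ≡⟨ prod-* _ _ N ⟩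
  prod (λ p → V (30 * n) p * V n p) N ≡⟨ prod-cong N (λ p _ → pointwise p) ⟩
  prod (λ p → R p * (V (15 * n) p * V (10 * n) p * V (6 * n) p)) N ≡⟨ prod-* _ _ N ⟨
  prod R N * prod (λ p → V (15 * n) p * V (10 * n) p * V (6 * n) p) N
    ≡⟨ cong (prod R N *_) (trans (cong (_* prod (V (6 * n)) N) (prod-* _ _ N)) (prod-* _ _ N)) ⟨
  prod R N * (prod (V (15 * n)) N * prod (V (10 * n)) N * prod (V (6 * n)) N)
    ≡⟨ cong (prod R N *_) (cong₂ _*_ (cong₂ _*_ (leg (15 * n) (scale 15)) (leg (10 * n) (scale 10))) (leg (6 * n) (scale 6))) ⟨
  chebyshevRatio n * ((15 * n) ! * (10 * n) ! * (6 * n) !) ∎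
  where
  open ≡-Reasoning
  N = suc (30 * n)
  E : ℕ → ℕ → ℕ
  E m p = sum (λ k → multiples (p ^ suc k) m) N
  V : ℕ → ℕ → ℕ
  V m p = primePower p (E m p)
  R : ℕ → ℕ
  R p = primePower p (ratioExponent N n p)
  leg : ∀ m → m ≤ 30 * n → m ! ≡ prod (V m) N
  leg m le = Eq.sym (legendre (30 * n) N m (m≤n⇒m≤1+n le) (s≤s le))
  scale : ∀ a → {_ : True (a ≤? 30)} → a * n ≤ 30 * n
  scale a {le} = *-monoˡ-≤ n (toWitness le)
  exponents : ∀ p → Prime p →
    E (30 * n) p + E n p ≡ ratioExponent N n p + (E (15 * n) p + E (10 * n) p + E (6 * n) p)
  exponents p pp = begin
    E (30 * n) p + E n p ≡⟨ sum-+ _ _ N ⟩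
    sum (λ k → multiples (p ^ suc k) (30 * n) + multiples (p ^ suc k) n) N
      ≡⟨ sum-cong N (λ k → multiples-identity (p ^ suc k) n {{m^n≢0 p (suc k)}}) ⟩
    sum (λ k → φ (multiples (p ^ suc k) (30 * n)) + (multiples (p ^ suc k) (15 * n)
      + multiples (p ^ suc k) (10 * n) + multiples (p ^ suc k) (6 * n))) N
      ≡⟨ sum-+ _ _ N ⟨
    ratioExponent N n p + sum (λ k → multiples (p ^ suc k) (15 * n)
      + multiples (p ^ suc k) (10 * n) + multiples (p ^ suc k) (6 * n)) N
      ≡⟨ cong (ratioExponent N n p +_) (trans (cong (_+ E (6 * n) p) (sum-+ _ _ N)) (sum-+ _ _ N)) ⟨
    ratioExponent N n p + (E (15 * n) p + E (10 * n) p + E (6 * n) p) ∎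
    where
    instance
      p≢0 : NonZero p
      p≢0 = prime⇒nonZero pp
  pointwise : ∀ p → V (30 * n) p * V n p ≡ R p * (V (15 * n) p * V (10 * n) p * V (6 * n) p)
  pointwise p = begin
    V (30 * n) p * V n p ≡⟨ primePower-+ p _ _ ⟨
    primePower p (E (30 * n) p + E n p) ≡⟨ primePower-cong p (exponents p) ⟩
    primePower p (ratioExponent N n p + (E (15 * n) p + E (10 * n) p + E (6 * n) p)) ≡⟨ primePower-+ p _ _ ⟩
    R p * primePower p (E (15 * n) p + E (10 * n) p + E (6 * n) p)
      ≡⟨ cong (R p *_) (trans (primePower-+ p _ _) (cong (_* V (6 * n) p) (primePower-+ p _ _))) ⟩
    R p * (V (15 * n) p * V (10 * n) p * V (6 * n) p) ∎

-- Primorials against the Chebyshev ratio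

prod-tail : ∀ {f} M k → (∀ i → M ≤ i → f i ≡ 1) → prod f (k + M) ≡ prod f M
prod-tail M zero eq = refl
prod-tail M (suc k) eq = trans (cong₂ _*_ (prod-tail M k eq) (eq (k + M) (m≤n+m M k))) (*-identityʳ _)

prod-extend : ∀ {f} N k → (∀ i → 1 ≤ f i) → prod f N ≤ prod f (k + N)
prod-extend N zero pos = ≤-refl
prod-extend {f} N (suc k) pos =
  ≤-trans (prod-extend N k pos) (m≤m*n _ (f (k + N)) {{>-nonZero (pos (k + N))}})

-- Passing through the longer range N + M avoids a case distinction on which of N and M is larger.
prod-truncate : ∀ {f} N M → (∀ i → 1 ≤ f i) → (∀ i → M ≤ i → f i ≡ 1) → prod f N ≤ prod f M
prod-truncate {f} N M pos eq = begin
  prod f N ≤⟨ prod-extend N M pos ⟩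
  prod f (M + N) ≡⟨ cong (prod f) (+-comm M N) ⟩
  prod f (N + M) ≡⟨ prod-tail M N eq ⟩
  prod f M ∎
  where open ≤-Reasoning

prod-≤-^ : ∀ {f b} N → (∀ i → i < N → f i ≤ b) → prod f N ≤ b ^ N
prod-≤-^ zero le = ≤-refl
prod-≤-^ {f} {b} (suc N) le = ≤-trans
  (*-mono-≤ (prod-≤-^ N λ i i<N → le i (m<n⇒m<1+n i<N)) (le N ≤-refl)) (≤-reflexive (*-comm (b ^ N) b))

primePower≥1 : ∀ p e → 1 ≤ primePower p e
primePower≥1 p e with prime? p
... | yes pp = m^n>0 p {{prime⇒nonZero pp}} (1 * e)
... | no _ = ≤-refl

primorialFactor : ℕ → ℕ → ℕ
primorialFactor y p = primePower p (indicator (p ≤? y))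

primorial : ℕ → ℕ
primorial y = prod (λ p → primePower p 1) (suc y)

primorialFactor-≤ : ∀ {y p} → p ≤ y → primorialFactor y p ≡ primePower p 1
primorialFactor-≤ {y} {p} le = cong (primePower p) (indicator-yes (p ≤? y) le)

prod-primorialFactor : ∀ y N → prod (primorialFactor y) N ≤ primorial y
prod-primorialFactor y N = begin
  prod (primorialFactor y) N
    ≤⟨ prod-truncate N (suc y) (λ p → primePower≥1 p _)
         (λ p y<p → trans (cong (primePower p) (indicator-no (p ≤? y) (<⇒≱ y<p))) (primePower-0 p)) ⟩
  prod (primorialFactor y) (suc y) ≡⟨ prod-cong (suc y) (λ p p≤y → primorialFactor-≤ (s≤s⁻¹ p≤y)) ⟩
  primorial y ∎
  where open ≤-Reasoning

primorial-mono : ∀ {x y} → x ≤ y → primorial x ≤ primorial y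
primorial-mono {x} {y} x≤y = subst (λ N → primorial x ≤ prod (λ p → primePower p 1) N)
  (trans (+-suc (y ∸ x) x) (cong suc (m∸n+n≡m x≤y)))
  (prod-extend (suc x) (y ∸ x) λ p → primePower≥1 p 1)

multiples-large : ∀ {d m} → m < d → multiples d m ≡ 0
multiples-large {d} {m} m<d = trans (multiples≡/ d m) (m<n⇒m/n≡0 m<d)
  where
  instance
    d≢0 : NonZero d
    d≢0 = >-nonZero (m<n⇒0<n m<d)

-- Here ⌊30n/p⌋ lies between 1 and 5, where `φ` is 1. The cutoff 5n comes from `φ 6` being 0.
ratioExponent≥1 : ∀ K n p → Prime p → 5 * n < p → p ≤ 30 * n → 1 ≤ ratioExponent (suc K) n p
ratioExponent≥1 K n p pp 5n<p p≤30n = begin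
  1 ≡⟨ φ-small e 1≤e e<6 ⟨
  φ e ≤⟨ m≤m+n (φ e) _ ⟩
  φ e + sum (λ k → φ (multiples (p ^ suc (suc k)) (30 * n))) K
    ≡⟨ sum-shift (λ k → φ (multiples (p ^ suc k) (30 * n))) K ⟨
  ratioExponent (suc K) n p ∎
  where
  open ≤-Reasoning
  instance
    p≢0 : NonZero p
    p≢0 = prime⇒nonZero pp
  e = multiples (p ^ 1) (30 * n)
  e≡ : e ≡ 30 * n / p
  e≡ = trans (cong (λ x → multiples x (30 * n)) (^-identityʳ p)) (multiples≡/ p (30 * n))
  1≤e : 1 ≤ e
  1≤e = subst (1 ≤_) (Eq.sym e≡) (m≥n⇒m/n>0 p≤30n)
  e<6 : e < 6
  e<6 = subst (_< 6) (Eq.sym e≡) (m<n*o⇒m/o<n (begin-strict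
    30 * n ≡⟨ *-assoc 6 5 n ⟩
    6 * (5 * n) <⟨ *-monoʳ-< 6 5n<p ⟩
    6 * p ∎))

-- The primes in (5n, 30n] all divide the ratio. Iterated, this costs (1/30)(1 + 1/6 + 1/36 + ...) =
-- 1/25 in the exponent, against 1/30 for the ratio itself; the quotient is the 6/5 of the method.
primorial-step : ∀ n → primorial (30 * n) ≤ chebyshevRatio n * primorial (5 * n)
primorial-step n = begin
  primorial (30 * n) ≤⟨ prod-mono N (λ p p<N → pointwise p (s≤s⁻¹ p<N)) ⟩
  prod (λ p → R p * primorialFactor (5 * n) p) N ≡⟨ prod-* R _ N ⟨
  chebyshevRatio n * prod (primorialFactor (5 * n)) N
    ≤⟨ *-monoʳ-≤ (chebyshevRatio n) (prod-primorialFactor (5 * n) N) ⟩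
  chebyshevRatio n * primorial (5 * n) ∎
  where
  open ≤-Reasoning
  N = suc (30 * n)
  R : ℕ → ℕ
  R p = primePower p (ratioExponent N n p)
  pointwise : ∀ p → p ≤ 30 * n → primePower p 1 ≤ R p * primorialFactor (5 * n) p
  pointwise p p≤30n with p ≤? 5 * n
  ... | yes _ = m≤n*m _ (R p) {{>-nonZero (primePower≥1 p _)}}
  ... | no p≰5n = ≤-trans
    (primePower-mono p (λ pp → subst (p ^ 1 ≤_) (Eq.sym (primePower-prime _ pp))
      (^-monoʳ-≤ p {{prime⇒nonZero pp}} (ratioExponent≥1 (30 * n) n p pp (≰⇒> p≰5n) p≤30n)))
      (primePower≥1 p _))
    (m≤m*n (R p) _ {{>-nonZero (primePower≥1 p 0)}})

-- Each power of p up to 30n adds at most 1 to the exponent and larger powers add nothing, so p to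
-- this exponent is at most the largest such power. The bound by K is carried along for the
-- induction.
ratioExponent-bound : ∀ K n p → Prime p → 1 ≤ n → p ^ ratioExponent K n p ≤ 30 * n × ratioExponent K n p ≤ K
ratioExponent-bound zero n p pp 1≤n = ≤-trans 1≤n (m≤n*m n 30) , z≤n
ratioExponent-bound (suc K) n p pp 1≤n with ratioExponent-bound K n p pp 1≤n | p ^ suc K ≤? 30 * n
... | _ , E≤K | yes small = ≤-trans (^-monoʳ-≤ p {{prime⇒nonZero pp}} E'≤) small , E'≤
  where
  E'≤ : ratioExponent (suc K) n p ≤ suc K
  E'≤ = ≤-trans (+-mono-≤ E≤K (φ≤1 (multiples (p ^ suc K) (30 * n)))) (≤-reflexive (+-comm K 1))
... | pE≤ , E≤K | no large = subst (λ E → p ^ E ≤ 30 * n) (Eq.sym E≡) pE≤ ,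
                            subst (_≤ suc K) (Eq.sym E≡) (m≤n⇒m≤1+n E≤K)
  where
  E≡ : ratioExponent (suc K) n p ≡ ratioExponent K n p
  E≡ = trans (cong (λ x → ratioExponent K n p + φ x) (multiples-large (≰⇒> large))) (+-identityʳ _)

ratioExponent≤1 : ∀ K n p → Prime p → 30 * n < p * p → ratioExponent (suc K) n p ≤ 1
ratioExponent≤1 K n p pp 30n<p² = begin
  ratioExponent (suc K) n p ≡⟨ sum-shift (λ k → φ (multiples (p ^ suc k) (30 * n))) K ⟩
  φ (multiples (p ^ 1) (30 * n)) + sum (λ k → φ (multiples (p ^ suc (suc k)) (30 * n))) K
    ≡⟨ cong (φ (multiples (p ^ 1) (30 * n)) +_) (sum-0 K λ k → cong φ (multiples-large (30n< k))) ⟩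
  φ (multiples (p ^ 1) (30 * n)) + 0 ≡⟨ +-identityʳ _ ⟩
  φ (multiples (p ^ 1) (30 * n)) ≤⟨ φ≤1 (multiples (p ^ 1) (30 * n)) ⟩
  1 ∎
  where
  open ≤-Reasoning
  instance
    p≢0 : NonZero p
    p≢0 = prime⇒nonZero pp
  30n< : ∀ k → 30 * n < p ^ suc (suc k)
  30n< k = <-≤-trans 30n<p² (*-monoʳ-≤ p (m≤m*n p (p ^ k) {{m^n≢0 p k}}))

-- A prime p ≥ s has p² > 30n, hence exponent at most 1, and is at most y by the gap, so the
-- primorial pays for it. Each of the fewer than s smaller primes contributes at most 30n.
chebyshevRatio-prime-gap : ∀ n y s → 1 ≤ n → 30 * n < s * s → (∀ p → Prime p → p ≤ 30 * n → p ≤ y) →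
  chebyshevRatio n ≤ primorial y * (30 * n) ^ s
chebyshevRatio-prime-gap n y s 1≤n 30n<s² gap = begin
  prod R N ≤⟨ prod-mono N (λ p p<N → primePower-mono p (λ pp → pointwise p pp (s≤s⁻¹ p<N)) (≥1 p)) ⟩
  prod (λ p → primorialFactor y p * S p) N ≡⟨ prod-* _ S N ⟨
  prod (primorialFactor y) N * prod S N ≤⟨ *-mono-≤ (prod-primorialFactor y N) S-bound ⟩
  primorial y * B ^ s ∎
  where
  open ≤-Reasoning
  B = 30 * n
  N = suc B
  R S : ℕ → ℕ
  R p = primePower p (ratioExponent N n p)
  S p = B ^ indicator (p <? s)
  1≤B : 1 ≤ B
  1≤B = ≤-trans 1≤n (m≤n*m n 30)
  S≥1 : ∀ p → 1 ≤ S p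
  S≥1 p = m^n>0 B {{>-nonZero 1≤B}} (indicator (p <? s))
  ≥1 : ∀ p → 1 ≤ primorialFactor y p * S p
  ≥1 p = *-mono-≤ (primePower≥1 p _) (S≥1 p)
  S-bound : prod S N ≤ B ^ s
  S-bound = ≤-trans
    (prod-truncate N s S≥1 (λ p s≤p → cong (B ^_) (indicator-no (p <? s) (≤⇒≯ s≤p))))
    (prod-≤-^ s λ p p<s → ≤-reflexive (trans (cong (B ^_) (indicator-yes (p <? s) p<s)) (^-identityʳ B)))
  pointwise : ∀ p → Prime p → p ≤ B → p ^ ratioExponent N n p ≤ primorialFactor y p * S p
  pointwise p pp p≤B with p <? s
  ... | yes _ = ≤-trans (proj₁ (ratioExponent-bound N n p pp 1≤n))
    (≤-trans (≤-reflexive (Eq.sym (^-identityʳ B))) (m≤n*m (B ^ 1) _ {{>-nonZero (primePower≥1 p _)}}))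
  ... | no p≮s = begin
    p ^ ratioExponent N n p
      ≤⟨ ^-monoʳ-≤ p {{prime⇒nonZero pp}} (ratioExponent≤1 B n p pp
           (<-≤-trans 30n<s² (*-mono-≤ (≮⇒≥ p≮s) (≮⇒≥ p≮s)))) ⟩
    p ^ 1 ≡⟨ primePower-prime 1 pp ⟨
    primePower p 1 ≡⟨ primorialFactor-≤ (gap p pp p≤B) ⟨
    primorialFactor y p ≡⟨ *-identityʳ _ ⟨
    primorialFactor y p * 1 ∎

-- Growth of the Chebyshev ratio

-- Passing from n to n + 1 multiplies numerator and denominator of the Chebyshev ratio by
-- polynomials of degree 31 whose leading coefficients have quotient `base`. Comparing their
-- coefficients, a finite computation, takes the place of Stirling's formula.
Poly : Set
Poly = List ℕ

eval : Poly → ℕ → ℕ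
eval [] x = 0
eval (a ∷ as) x = a + x * eval as x

scale : ℕ → Poly → Poly
scale c [] = []
scale c (a ∷ as) = c * a ∷ scale c as

infixl 6 _⊕_
_⊕_ : Poly → Poly → Poly
[] ⊕ bs = bs
(a ∷ as) ⊕ [] = a ∷ as
(a ∷ as) ⊕ (b ∷ bs) = a + b ∷ (as ⊕ bs)

infixl 7 _⊗_
_⊗_ : Poly → Poly → Poly
[] ⊗ bs = []
(a ∷ as) ⊗ bs = scale a bs ⊕ (0 ∷ as ⊗ bs)

infix 4 _≼_
_≼_ : Poly → Poly → Bool
[] ≼ bs = true
(a ∷ as) ≼ [] = false
(a ∷ as) ≼ (b ∷ bs) = (a ≤ᵇ b) ∧ (as ≼ bs)

eval-scale : ∀ c as x → eval (scale c as) x ≡ c * eval as x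
eval-scale c [] x = Eq.sym (*-zeroʳ c)
eval-scale c (a ∷ as) x rewrite eval-scale c as x = lemma c a x (eval as x)
  where
  lemma : ∀ c a x e → c * a + x * (c * e) ≡ c * (a + x * e)
  lemma = solve-∀

eval-⊕ : ∀ as bs x → eval (as ⊕ bs) x ≡ eval as x + eval bs x
eval-⊕ [] bs x = refl
eval-⊕ (a ∷ as) [] x = Eq.sym (+-identityʳ _)
eval-⊕ (a ∷ as) (b ∷ bs) x rewrite eval-⊕ as bs x = lemma a b x (eval as x) (eval bs x)
  where
  lemma : ∀ a b x e f → a + b + x * (e + f) ≡ (a + x * e) + (b + x * f)
  lemma = solve-∀

eval-⊗ : ∀ as bs x → eval (as ⊗ bs) x ≡ eval as x * eval bs x
eval-⊗ [] bs x = refl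
eval-⊗ (a ∷ as) bs x
  rewrite eval-⊕ (scale a bs) (0 ∷ as ⊗ bs) x | eval-scale a bs x | eval-⊗ as bs x
  = lemma a x (eval as x) (eval bs x)
  where
  lemma : ∀ a x e f → a * f + x * (e * f) ≡ (a + x * e) * f
  lemma = solve-∀

≼⇒≤ : ∀ as bs x → T (as ≼ bs) → eval as x ≤ eval bs x
≼⇒≤ [] bs x _ = z≤n
≼⇒≤ (a ∷ as) (b ∷ bs) x t with Equivalence.to T-∧ t
... | a≤b , as≼bs = +-mono-≤ (≤ᵇ⇒≤ a b a≤b) (*-monoʳ-≤ x (≼⇒≤ as bs x as≼bs))

-- (a n + 1) (a n + 2) ⋯ (a n + k) as a polynomial in n.
rising : ℕ → ℕ → Poly
rising a zero = 1 ∷ []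
rising a (suc k) = (suc k ∷ a ∷ []) ⊗ rising a k

factorial-rising : ∀ a n k → (a * n + k) ! ≡ eval (rising a k) n * (a * n) !
factorial-rising a n zero rewrite +-identityʳ (a * n) | *-zeroʳ n = Eq.sym (*-identityˡ _)
factorial-rising a n (suc k)
  rewrite +-suc (a * n) k | eval-⊗ (suc k ∷ a ∷ []) (rising a k) n | factorial-rising a n k
  = lemma (a * n) k n a (eval (rising a k) n) ((a * n) !) refl
  where
  lemma : ∀ m k n a e f → m ≡ a * n → suc (m + k) * (e * f) ≡ (suc k + n * (a + n * 0)) * e * f
  lemma _ k n a e f refl = expand k n a e f
    where
    expand : ∀ k n a e f → suc (a * n + k) * (e * f) ≡ (suc k + n * (a + n * 0)) * e * f
    expand = solve-∀

factorial-suc : ∀ a n → (a * suc n) ! ≡ eval (rising a a) n * (a * n) !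
factorial-suc a n = trans (cong _! (trans (*-suc a n) (+-comm a (a * n)))) (factorial-rising a n a)

rising₂ : ℕ → ℕ → Poly
rising₂ a b = rising a a ⊗ rising b b

rising₃ : ℕ → ℕ → ℕ → Poly
rising₃ a b c = rising₂ a b ⊗ rising c c

factorials₂ : ℕ → ℕ → ℕ → ℕ
factorials₂ a b n = (a * n) ! * (b * n) !

factorials₃ : ℕ → ℕ → ℕ → ℕ → ℕ
factorials₃ a b c n = (a * n) ! * (b * n) ! * (c * n) !

factorials₂-suc : ∀ a b n → factorials₂ a b (suc n) ≡ eval (rising₂ a b) n * factorials₂ a b n
factorials₂-suc a b n rewrite eval-⊗ (rising a a) (rising b b) n =
  trans (cong₂ _*_ (factorial-suc a n) (factorial-suc b n))
    (*-interchange (eval (rising a a) n) ((a * n) !) (eval (rising b b) n) ((b * n) !))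

factorials₃-suc : ∀ a b c n → factorials₃ a b c (suc n) ≡ eval (rising₃ a b c) n * factorials₃ a b c n
factorials₃-suc a b c n rewrite eval-⊗ (rising₂ a b) (rising c c) n =
  trans (cong₂ _*_ (factorials₂-suc a b n) (factorial-suc c n))
    (*-interchange (eval (rising₂ a b) n) (factorials₂ a b n) (eval (rising c c) n) ((c * n) !))

module _ (c : ℕ) (u v p q : ℕ → ℕ)
  (u-suc : ∀ n → u (suc n) ≡ p n * u n) (v-suc : ∀ n → v (suc n) ≡ q n * v n) where

  ratio-upper : u 0 ≤ v 0 → (∀ n → p n ≤ c * q n) → ∀ n → u n ≤ c ^ n * v n
  ratio-upper base step zero = ≤-trans base (≤-reflexive (Eq.sym (+-identityʳ (v 0))))
  ratio-upper base step (suc n) = begin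
    u (suc n) ≡⟨ u-suc n ⟩
    p n * u n ≤⟨ *-mono-≤ (step n) (ratio-upper base step n) ⟩
    c * q n * (c ^ n * v n) ≡⟨ *-interchange c (q n) (c ^ n) (v n) ⟩
    c ^ suc n * (q n * v n) ≡⟨ cong (c ^ suc n *_) (v-suc n) ⟨
    c ^ suc n * v (suc n) ∎
    where open ≤-Reasoning

  ratio-lower : (w : ℕ → ℕ) → (∀ n → 1 ≤ w n) → v 0 ≤ u 0 * w 0 →
    (∀ n → c * q n * w n ≤ p n * w (suc n)) → ∀ n → c ^ n * v n ≤ u n * w n
  ratio-lower w pos base step zero = ≤-trans (≤-reflexive (+-identityʳ (v 0))) base
  ratio-lower w pos base step (suc n) = *-cancelʳ-≤ _ _ (w n) {{>-nonZero (pos n)}} (begin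
    c ^ suc n * v (suc n) * w n ≡⟨ cong (λ x → c ^ suc n * x * w n) (v-suc n) ⟩
    c ^ suc n * (q n * v n) * w n ≡⟨ regroup c (c ^ n) (q n) (v n) (w n) ⟩
    c * q n * w n * (c ^ n * v n) ≤⟨ *-mono-≤ (step n) (ratio-lower w pos base step n) ⟩
    p n * w (suc n) * (u n * w n) ≡⟨ regroup′ (p n) (w (suc n)) (u n) (w n) ⟩
    p n * u n * w (suc n) * w n ≡⟨ cong (λ x → x * w (suc n) * w n) (u-suc n) ⟨
    u (suc n) * w (suc n) * w n ∎)
    where
    open ≤-Reasoning
    regroup : ∀ c d q v w → c * d * (q * v) * w ≡ c * q * w * (d * v)
    regroup = solve-∀
    regroup′ : ∀ p w u x → p * w * (u * x) ≡ p * u * w * x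
    regroup′ = solve-∀

poly-upper : ∀ c p q → T (p ≼ scale c q) → ∀ n → eval p n ≤ c * eval q n
poly-upper c p q p≼cq n = ≤-trans (≼⇒≤ p (scale c q) n p≼cq) (≤-reflexive (eval-scale c q n))

-- The Chebyshev ratio is of order `base ^ n` / √n, so a lower bound needs a growing weight; the
-- linear weight 30n + 1 grows fast enough for the comparison to hold coefficient by coefficient.
poly-lower : ∀ c p q → T (scale c q ⊗ (1 ∷ 30 ∷ []) ≼ p ⊗ (31 ∷ 30 ∷ [])) →
  ∀ n → c * eval q n * suc (30 * n) ≤ eval p n * suc (30 * suc n)
poly-lower c p q check n = begin
  c * eval q n * suc (30 * n) ≡⟨ cong₂ _*_ (eval-scale c q n) (weight n) ⟨
  eval (scale c q) n * eval (1 ∷ 30 ∷ []) n ≡⟨ eval-⊗ (scale c q) (1 ∷ 30 ∷ []) n ⟨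
  eval (scale c q ⊗ (1 ∷ 30 ∷ [])) n ≤⟨ ≼⇒≤ (scale c q ⊗ (1 ∷ 30 ∷ [])) (p ⊗ (31 ∷ 30 ∷ [])) n check ⟩
  eval (p ⊗ (31 ∷ 30 ∷ [])) n ≡⟨ eval-⊗ p (31 ∷ 30 ∷ []) n ⟩
  eval p n * eval (31 ∷ 30 ∷ []) n ≡⟨ cong (eval p n *_) (weight-suc n) ⟩
  eval p n * suc (30 * suc n) ∎
  where
  open ≤-Reasoning
  weight : ∀ n → 1 + n * (30 + n * 0) ≡ suc (30 * n)
  weight = solve-∀
  weight-suc : ∀ n → 31 + n * (30 + n * 0) ≡ suc (30 * suc n)
  weight-suc = solve-∀

abstract
  -- 30³⁰ / (15¹⁵ 10¹⁰ 6⁶)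
  base : ℕ
  base = 2 ^ 14 * 3 ^ 9 * 5 ^ 5

  1771≤base : 1771 ≤ base
  1771≤base = ≤ᵇ⇒≤ 1771 base tt

  rising-upper : ∀ n → eval (rising₂ 30 1) n ≤ base * eval (rising₃ 15 10 6) n
  rising-upper = poly-upper base (rising₂ 30 1) (rising₃ 15 10 6) tt

  rising-lower : ∀ n → base * eval (rising₃ 15 10 6) n * suc (30 * n) ≤ eval (rising₂ 30 1) n * suc (30 * suc n)
  rising-lower = poly-lower base (rising₂ 30 1) (rising₃ 15 10 6) tt

factorials-ratio : ∀ n → factorials₂ 30 1 n ≡ chebyshevRatio n * factorials₃ 15 10 6 n
factorials-ratio n = trans (cong (λ m → (30 * n) ! * m !) (*-identityˡ n)) (chebyshev-factorials n)

factorials₃≢0 : ∀ a b c n → NonZero (factorials₃ a b c n)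
factorials₃≢0 a b c n = m*n≢0 _ _ {{m*n≢0 _ _ {{(a * n) !≢0}} {{(b * n) !≢0}}}} {{(c * n) !≢0}}

chebyshevRatio-upper : ∀ n → chebyshevRatio n ≤ base ^ n
chebyshevRatio-upper n = *-cancelʳ-≤ _ _ (factorials₃ 15 10 6 n) {{factorials₃≢0 15 10 6 n}}
  (subst (_≤ base ^ n * factorials₃ 15 10 6 n) (factorials-ratio n)
    (ratio-upper base (factorials₂ 30 1) (factorials₃ 15 10 6) (eval (rising₂ 30 1)) (eval (rising₃ 15 10 6))
      (factorials₂-suc 30 1) (factorials₃-suc 15 10 6) ≤-refl rising-upper n))

chebyshevRatio-lower : ∀ n → base ^ n ≤ chebyshevRatio n * suc (30 * n)
chebyshevRatio-lower n = *-cancelʳ-≤ _ _ (factorials₃ 15 10 6 n) {{factorials₃≢0 15 10 6 n}} (begin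
  base ^ n * factorials₃ 15 10 6 n
    ≤⟨ ratio-lower base (factorials₂ 30 1) (factorials₃ 15 10 6) (eval (rising₂ 30 1)) (eval (rising₃ 15 10 6))
         (factorials₂-suc 30 1) (factorials₃-suc 15 10 6) (λ n → suc (30 * n)) (λ _ → s≤s z≤n) ≤-refl rising-lower n ⟩
  factorials₂ 30 1 n * suc (30 * n) ≡⟨ cong (_* suc (30 * n)) (factorials-ratio n) ⟩
  chebyshevRatio n * factorials₃ 15 10 6 n * suc (30 * n)
    ≡⟨ swap (chebyshevRatio n) (factorials₃ 15 10 6 n) (suc (30 * n)) ⟩
  chebyshevRatio n * suc (30 * n) * factorials₃ 15 10 6 n ∎)
  where
  open ≤-Reasoning
  swap : ∀ a b c → a * b * c ≡ a * c * b
  swap = solve-∀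

-- Primes in short intervals

^-distribʳ-* : ∀ x y a → (x * y) ^ a ≡ x ^ a * y ^ a
^-distribʳ-* x y zero = refl
^-distribʳ-* x y (suc a) = trans (cong (x * y *_) (^-distribʳ-* x y a)) (*-interchange x y (x ^ a) (y ^ a))

^-cancelˡ-≤ : ∀ c {x y} → 2 ≤ c → c ^ x ≤ c ^ y → x ≤ y
^-cancelˡ-≤ c 2≤c le = ≮⇒≥ λ y<x → <⇒≱ (^-monoʳ-< c 2≤c y<x) le

-- The primorial is bounded by a fractional power of `base`, which is expressed through its a-th
-- power; this carries a product inequality over to a-th powers.
absorb : ∀ c a e {x y w} → x ≤ w * y → y ^ a ≤ c ^ e → x ^ a ≤ w ^ a * c ^ e
absorb c a e {x} {y} {w} x≤ ya≤ = begin
  x ^ a ≤⟨ ^-monoˡ-≤ a x≤ ⟩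
  (w * y) ^ a ≡⟨ ^-distribʳ-* w y a ⟩
  w ^ a * y ^ a ≤⟨ *-monoʳ-≤ (w ^ a) ya≤ ⟩
  w ^ a * c ^ e ∎
  where open ≤-Reasoning

2≤base : 2 ≤ base
2≤base = ≤-trans (≤ᵇ⇒≤ 2 1771 tt) 1771≤base

instance
  base≢0 : NonZero base
  base≢0 = >-nonZero (≤-trans (s≤s z≤n) 2≤base)

primorial-trivial : ∀ y → y ≤ 1770 → primorial y ≤ base ^ suc y
primorial-trivial y y≤ = prod-≤-^ (suc y) λ p p≤y → primePower-mono p
  (λ _ → ≤-trans (≤-reflexive (^-identityʳ p)) (≤-trans (s≤s⁻¹ p≤y) (≤-trans y≤ (≤-trans (n≤1+n 1770) 1771≤base))))
  (≤-trans (s≤s z≤n) 2≤base)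

-- Kept abstract so that powers with these exponents are never unfolded.
abstract
  boundExponent primorialSlack : ℕ
  boundExponent = 1200
  primorialSlack = 1771 * boundExponent

  boundExponent≡ : boundExponent ≡ 1200
  boundExponent≡ = refl

  primorialSlack≡ : primorialSlack ≡ 1771 * boundExponent
  primorialSlack≡ = refl

-- Iterating primorial (30 m) ≤ base ^ m * primorial (5 m) would give the exponent y / 25 if 30 divided y all along;
-- 49 / 1200 = (1 / 25) (49 / 48) leaves room for rounding.
primorial-bound : ∀ y → primorial y ^ boundExponent ≤ base ^ (49 * y + primorialSlack)
primorial-bound = <-rec _ step
  where
  open ≤-Reasoning
  -- One step costs 1200 + 49 · 5 = 1445 per unit of m, while 49 · 30 = 1470 are available. The
  -- surplus 25m pays for rounding y up to 30m, at most 49 · 30 = 1470, once m ≥ 59; hence the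
  -- direct estimate up to 1770 = 30 · 59.
  arith : ∀ m y → 59 ≤ m → 30 * m ≤ y + 30 → ∀ K → m * boundExponent + (49 * (5 * m) + K) ≤ 49 * y + K
  arith m y 59≤m 30m≤ K = begin
    m * boundExponent + (49 * (5 * m) + K) ≡⟨ e₁ m K ⟩
    1445 * m + K ≤⟨ +-monoˡ-≤ K (+-cancelʳ-≤ 1470 _ _ (begin
      1445 * m + 1470 ≤⟨ +-monoʳ-≤ (1445 * m) (≤-trans (m≤m+n 1470 5) (*-monoʳ-≤ 25 59≤m)) ⟩
      1445 * m + 25 * m ≡⟨ e₂ m ⟩
      49 * (30 * m) ≤⟨ *-monoʳ-≤ 49 30m≤ ⟩
      49 * (y + 30) ≡⟨ *-distribˡ-+ 49 y 30 ⟩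
      49 * y + 1470 ∎)) ⟩
    49 * y + K ∎
    where
    e₁′ : ∀ m K → m * 1200 + (49 * (5 * m) + K) ≡ 1445 * m + K
    e₁′ = solve-∀
    e₁ : ∀ m K → m * boundExponent + (49 * (5 * m) + K) ≡ 1445 * m + K
    e₁ m K = trans (cong (λ x → m * x + (49 * (5 * m) + K)) boundExponent≡) (e₁′ m K)
    e₂ : ∀ m → 1445 * m + 25 * m ≡ 49 * (30 * m)
    e₂ = solve-∀
  step : ∀ y → (∀ {z} → z < y → primorial z ^ boundExponent ≤ base ^ (49 * z + primorialSlack)) →
    primorial y ^ boundExponent ≤ base ^ (49 * y + primorialSlack)
  step y rec with y ≤? 1770
  ... | yes y≤ = begin
    primorial y ^ boundExponent ≤⟨ ^-monoˡ-≤ boundExponent (primorial-trivial y y≤) ⟩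
    (base ^ suc y) ^ boundExponent ≡⟨ ^-*-assoc base (suc y) boundExponent ⟩
    base ^ (suc y * boundExponent) ≤⟨ ^-monoʳ-≤ base (≤-trans (≤-trans (*-monoˡ-≤ boundExponent (s≤s y≤)) (≤-reflexive (Eq.sym primorialSlack≡))) (m≤n+m primorialSlack (49 * y))) ⟩
    base ^ (49 * y + primorialSlack) ∎
  ... | no y≰ = begin
    primorial y ^ boundExponent ≤⟨ absorb base boundExponent (49 * (5 * m) + primorialSlack) primorial≤ (rec 5m<y) ⟩
    (base ^ m) ^ boundExponent * base ^ (49 * (5 * m) + primorialSlack)
      ≡⟨ cong (_* base ^ (49 * (5 * m) + primorialSlack)) (^-*-assoc base m boundExponent) ⟩
    base ^ (m * boundExponent) * base ^ (49 * (5 * m) + primorialSlack)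
      ≡⟨ ^-distribˡ-+-* base (m * boundExponent) (49 * (5 * m) + primorialSlack) ⟨
    base ^ (m * boundExponent + (49 * (5 * m) + primorialSlack))
      ≤⟨ ^-monoʳ-≤ base (arith m y (≤-trans (n≤1+n 59) (s≤s (/-monoˡ-≤ 30 1770≤y))) 30m≤ primorialSlack) ⟩
    base ^ (49 * y + primorialSlack) ∎
    where
    m = suc (y / 30)
    1770≤y : 1770 ≤ y
    1770≤y = <⇒≤ (≰⇒> y≰)
    y≤30m : y ≤ 30 * m
    y≤30m = begin
      y ≡⟨ m≡m%n+[m/n]*n y 30 ⟩
      y % 30 + y / 30 * 30 ≤⟨ +-monoˡ-≤ (y / 30 * 30) (m%n≤n y 30) ⟩
      m * 30 ≡⟨ *-comm m 30 ⟩
      30 * m ∎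
    30m≤ : 30 * m ≤ y + 30
    30m≤ = begin
      30 * m ≡⟨ *-suc 30 (y / 30) ⟩
      30 + 30 * (y / 30) ≡⟨ cong (30 +_) (*-comm 30 (y / 30)) ⟩
      30 + y / 30 * 30 ≤⟨ +-monoʳ-≤ 30 (m/n*n≤m y 30) ⟩
      30 + y ≡⟨ +-comm 30 y ⟩
      y + 30 ∎
    5m<y : 5 * m < y
    5m<y = *-cancelˡ-< 6 _ _ (begin-strict
      6 * (5 * m) ≡⟨ *-assoc 6 5 m ⟨
      30 * m ≤⟨ 30m≤ ⟩
      y + 30 <⟨ +-monoʳ-< y (<-≤-trans (≤ᵇ⇒≤ 31 1770 tt) (≤-trans 1770≤y (m≤m+n y (4 * y)))) ⟩
      6 * y ∎)
    primorial≤ : primorial y ≤ base ^ m * primorial (5 * m)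
    primorial≤ = ≤-trans (primorial-mono y≤30m)
      (≤-trans (primorial-step m) (*-monoˡ-≤ (primorial (5 * m)) (chebyshevRatio-upper m)))

root : ∀ d .{{_ : NonZero d}} n → ∃[ u ] (u ^ d ≤ n × n < suc u ^ d)
root (suc d) zero = 0 , z≤n , m^n>0 1 (suc d)
root d (suc n) with root d n
... | u , u^d≤n , n< with suc u ^ d ≤? suc n
...   | yes le = suc u , le , ≤-<-trans n< (^-monoˡ-< d (n<1+n (suc u)))
...   | no gt = u , m≤n⇒m≤1+n u^d≤n , ≰⇒> gt

square≤2^ : ∀ k → (7 + k) ^ 2 ≤ 2 ^ (6 + k)
square≤2^ zero = ≤ᵇ⇒≤ 49 64 tt
square≤2^ (suc k) = begin
  (8 + k) ^ 2 ≤⟨ m≤m+n _ _ ⟩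
  (8 + k) ^ 2 + (k * k + 12 * k + 34) ≡⟨ lemma k ⟩
  2 * (7 + k) ^ 2 ≤⟨ *-monoʳ-≤ 2 (square≤2^ k) ⟩
  2 ^ (7 + k) ∎
  where
  open ≤-Reasoning
  lemma : ∀ k → (8 + k) * ((8 + k) * 1) + (k * k + 12 * k + 34) ≡ 2 * ((7 + k) * ((7 + k) * 1))
  lemma = solve-∀

-- With q = ⌊u/a⌋ one has u + 1 ≤ (q + 1) a ≤ (q + 1)² ≤ 2^q and q a ≤ u. The hypothesis gives q ≥ 6
-- + a: the 6 is for the square, the a for a ≤ q + 1.
power≤exponential : ∀ a .{{_ : NonZero a}} u → (6 + a) * a ≤ u → suc u ^ a ≤ 2 ^ u
power≤exponential a u le = begin
  suc u ^ a ≤⟨ ^-monoˡ-≤ a 1+u≤ ⟩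
  (2 ^ q) ^ a ≡⟨ ^-*-assoc 2 q a ⟩
  2 ^ (q * a) ≤⟨ ^-monoʳ-≤ 2 (m/n*n≤m u a) ⟩
  2 ^ u ∎
  where
  open ≤-Reasoning
  q = u / a
  6+a≤q : 6 + a ≤ q
  6+a≤q = subst (_≤ q) (m*n/n≡m (6 + a) a) (/-monoˡ-≤ a le)
  1+u≤ : suc u ≤ 2 ^ q
  1+u≤ = begin
    suc u ≡⟨ cong suc (m≡m%n+[m/n]*n u a) ⟩
    suc (u % a) + q * a ≤⟨ +-monoˡ-≤ (q * a) (m%n<n u a) ⟩
    suc q * a ≤⟨ *-monoʳ-≤ (suc q) (≤-trans (m≤n+m a 7) (s≤s 6+a≤q)) ⟩
    suc q * suc q ≡⟨ cong (suc q *_) (*-identityʳ (suc q)) ⟨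
    suc q ^ 2 ≤⟨ subst (λ x → suc x ^ 2 ≤ 2 ^ x) (m+[n∸m]≡n (≤-trans (m≤m+n 6 a) 6+a≤q)) (square≤2^ (q ∸ 6)) ⟩
    2 ^ q ∎

module _ (c K u n : ℕ) (2≤c : 2 ≤ c) (2≤u : 2 ≤ u) where
  private
    s = suc u
    instance
      c≢0 : NonZero c
      c≢0 = >-nonZero (≤-trans (s≤s z≤n) 2≤c)

  -- Since 1200 - 1176 = 24, cancelling leaves c^{24n} against s^{O(s)} with s about √(30n). In
  -- fourth powers the left exponent is 96n ≥ 2u²; one u² covers the power of s, by the assumption
  -- on 2^u, and the other exceeds 4K.
  growth-contradiction : u ^ 2 ≤ 30 * n → suc u ^ (16 * boundExponent) ≤ 2 ^ u → 4 * K < u →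
    ¬ c ^ (n * boundExponent) ≤ (s ^ (2 * s + 2)) ^ boundExponent * c ^ (1176 * n + K)
  growth-contradiction u²≤ exp 4K<u le = <⇒≱ (<-≤-trans 4K<u u≤u*u) u*u≤4K
    where
    open ≤-Reasoning
    u≤u*u : u ≤ u * u
    u≤u*u = m≤m*n u u {{>-nonZero (≤-trans (s≤s z≤n) 2≤u)}}
    e₁′ : ∀ n → n * 1200 ≡ 24 * n + 1176 * n
    e₁′ = solve-∀
    e₁ : ∀ n → n * boundExponent ≡ 24 * n + 1176 * n
    e₁ n = trans (cong (n *_) boundExponent≡) (e₁′ n)
    e₂ : ∀ x a b → x * (a * b) ≡ x * b * a
    e₂ = solve-∀
    24n : c ^ (24 * n) ≤ (s ^ (2 * s + 2)) ^ boundExponent * c ^ K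
    24n = *-cancelʳ-≤ _ _ (c ^ (1176 * n)) {{m^n≢0 c (1176 * n)}} (begin
      c ^ (24 * n) * c ^ (1176 * n) ≡⟨ ^-distribˡ-+-* c (24 * n) (1176 * n) ⟨
      c ^ (24 * n + 1176 * n) ≡⟨ cong (c ^_) (e₁ n) ⟨
      c ^ (n * boundExponent) ≤⟨ le ⟩
      (s ^ (2 * s + 2)) ^ boundExponent * c ^ (1176 * n + K)
        ≡⟨ cong ((s ^ (2 * s + 2)) ^ boundExponent *_) (^-distribˡ-+-* c (1176 * n) K) ⟩
      (s ^ (2 * s + 2)) ^ boundExponent * (c ^ (1176 * n) * c ^ K)
        ≡⟨ e₂ ((s ^ (2 * s + 2)) ^ boundExponent) (c ^ (1176 * n)) (c ^ K) ⟩
      (s ^ (2 * s + 2)) ^ boundExponent * c ^ K * c ^ (1176 * n) ∎)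
    s-exponent : (2 * s + 2) * boundExponent * 4 ≤ 16 * boundExponent * u
    s-exponent = begin
      (2 * s + 2) * boundExponent * 4 ≡⟨ f₁ u boundExponent ⟩
      8 * boundExponent * (u + 2) ≤⟨ *-monoʳ-≤ (8 * boundExponent) (+-monoʳ-≤ u 2≤u) ⟩
      8 * boundExponent * (u + u) ≡⟨ f₂ u boundExponent ⟩
      16 * boundExponent * u ∎
      where
      f₁ : ∀ u b → (2 * suc u + 2) * b * 4 ≡ 8 * b * (u + 2)
      f₁ = solve-∀
      f₂ : ∀ u b → 8 * b * (u + u) ≡ 16 * b * u
      f₂ = solve-∀
    2u² : 2 * (u * u) ≤ 24 * n * 4
    2u² = begin
      2 * (u * u) ≡⟨ cong (λ x → 2 * (u * x)) (*-identityʳ u) ⟨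
      2 * u ^ 2 ≤⟨ *-monoʳ-≤ 2 u²≤ ⟩
      2 * (30 * n) ≤⟨ m≤m+n _ (36 * n) ⟩
      2 * (30 * n) + 36 * n ≡⟨ f₂ n ⟩
      24 * n * 4 ∎
      where
      f₂ : ∀ n → 2 * (30 * n) + 36 * n ≡ 24 * n * 4
      f₂ = solve-∀
    s-power : ((s ^ (2 * s + 2)) ^ boundExponent) ^ 4 ≤ c ^ (u * u)
    s-power = begin
      ((s ^ (2 * s + 2)) ^ boundExponent) ^ 4 ≡⟨ cong (_^ 4) (^-*-assoc s (2 * s + 2) boundExponent) ⟩
      (s ^ ((2 * s + 2) * boundExponent)) ^ 4 ≡⟨ ^-*-assoc s ((2 * s + 2) * boundExponent) 4 ⟩
      s ^ ((2 * s + 2) * boundExponent * 4) ≤⟨ ^-monoʳ-≤ s s-exponent ⟩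
      s ^ ((16 * boundExponent) * u) ≡⟨ ^-*-assoc s (16 * boundExponent) u ⟨
      (s ^ (16 * boundExponent)) ^ u ≤⟨ ^-monoˡ-≤ u (≤-trans exp (^-monoˡ-≤ u 2≤c)) ⟩
      (c ^ u) ^ u ≡⟨ ^-*-assoc c u u ⟩
      c ^ (u * u) ∎
    u*u≤4K : u * u ≤ 4 * K
    u*u≤4K = +-cancelˡ-≤ (u * u) _ _ (^-cancelˡ-≤ c 2≤c (begin
      c ^ (u * u + u * u) ≡⟨ cong (λ x → c ^ (u * u + x)) (+-identityʳ (u * u)) ⟨
      c ^ (2 * (u * u)) ≤⟨ ^-monoʳ-≤ c 2u² ⟩
      c ^ (24 * n * 4) ≡⟨ ^-*-assoc c (24 * n) 4 ⟨
      (c ^ (24 * n)) ^ 4 ≤⟨ ^-monoˡ-≤ 4 24n ⟩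
      ((s ^ (2 * s + 2)) ^ boundExponent * c ^ K) ^ 4 ≡⟨ ^-distribʳ-* ((s ^ (2 * s + 2)) ^ boundExponent) (c ^ K) 4 ⟩
      ((s ^ (2 * s + 2)) ^ boundExponent) ^ 4 * (c ^ K) ^ 4 ≤⟨ *-mono-≤ s-power (≤-reflexive (^-*-assoc c K 4)) ⟩
      c ^ (u * u) * c ^ (K * 4) ≡⟨ cong (λ x → c ^ (u * u) * c ^ x) (*-comm K 4) ⟩
      c ^ (u * u) * c ^ (4 * K) ≡⟨ ^-distribˡ-+-* c (u * u) (4 * K) ⟨
      c ^ (u * u + 4 * K) ∎))

-- Both estimates of the Chebyshev ratio meet here. The error factors (30n)^s and 30n + 1 are at
-- most s^{2s} and s², and 49 · 24 = 1176 < 1200 is where a gap of ratio 5/4 becomes impossible for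
-- large n.
gap-bound : ∀ n u → 1 ≤ n → 30 * n < suc u ^ 2 → (∀ p → Prime p → p ≤ 30 * n → p ≤ 24 * suc n) →
  base ^ (n * boundExponent) ≤
    (suc u ^ (2 * suc u + 2)) ^ boundExponent * base ^ (1176 * n + (1176 + primorialSlack))
gap-bound n u 1≤n 30n<s² gap = begin
  base ^ (n * boundExponent) ≡⟨ ^-*-assoc base n boundExponent ⟨
  (base ^ n) ^ boundExponent
    ≤⟨ absorb base boundExponent (49 * (24 * suc n) + primorialSlack) base^n≤ (primorial-bound (24 * suc n)) ⟩
  (s ^ (2 * s + 2)) ^ boundExponent * base ^ (49 * (24 * suc n) + primorialSlack)
    ≡⟨ cong (λ e → (s ^ (2 * s + 2)) ^ boundExponent * base ^ e) (exponent n primorialSlack) ⟩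
  (s ^ (2 * s + 2)) ^ boundExponent * base ^ (1176 * n + (1176 + primorialSlack)) ∎
  where
  open ≤-Reasoning
  s = suc u
  exponent : ∀ n k → 49 * (24 * suc n) + k ≡ 1176 * n + (1176 + k)
  exponent = solve-∀
  regroup : ∀ p x y → p * x * y ≡ x * y * p
  regroup = solve-∀
  P = primorial (24 * suc n)
  base^n≤ : base ^ n ≤ s ^ (2 * s + 2) * P
  base^n≤ = begin
    base ^ n ≤⟨ chebyshevRatio-lower n ⟩
    chebyshevRatio n * suc (30 * n)
      ≤⟨ *-mono-≤ (chebyshevRatio-prime-gap n (24 * suc n) s 1≤n
           (<-≤-trans 30n<s² (≤-reflexive (cong (s *_) (*-identityʳ s)))) gap) 30n<s² ⟩
    P * (30 * n) ^ s * s ^ 2 ≤⟨ *-monoˡ-≤ (s ^ 2) (*-monoʳ-≤ P (^-monoˡ-≤ s (<⇒≤ 30n<s²))) ⟩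
    P * (s ^ 2) ^ s * s ^ 2 ≡⟨ cong (λ x → P * x * s ^ 2) (^-*-assoc s 2 s) ⟩
    P * s ^ (2 * s) * s ^ 2 ≡⟨ regroup P (s ^ (2 * s)) (s ^ 2) ⟩
    s ^ (2 * s) * s ^ 2 * P ≡⟨ cong (_* P) (^-distribˡ-+-* s (2 * s) 2) ⟨
    s ^ (2 * s + 2) * P ∎

Threshold : ℕ → ℕ → ℕ → Set
Threshold a k v = ∀ u → v ≤ u → 2 ≤ u × suc u ^ a ≤ 2 ^ u × k < u

prime-threshold : ∀ a k .{{_ : NonZero a}} → ∃[ v ] Threshold a k v
prime-threshold a k = 2 + x + suc k , λ u v≤u →
  ≤-trans (≤-trans (m≤m+n 2 x) (m≤m+n (2 + x) (suc k))) v≤u ,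
  power≤exponential a u (≤-trans (≤-trans (m≤n+m x 2) (m≤m+n (2 + x) (suc k))) v≤u) ,
  ≤-trans (m≤n+m (suc k) (2 + x)) v≤u
  where
  x = (6 + a) * a

prime-above : ∀ v → Threshold (16 * boundExponent) (4 * (1176 + primorialSlack)) v →
  ∀ t → 30 + v * v ≤ t → ∃[ p ] (Prime p × p ≤ t × 4 * suc t ≤ 5 * p)
prime-above v threshold t T≤t with anyUpTo? (λ p → prime? p ×-dec 4 * suc t ≤? 5 * p) (suc t)
-- The search range is finite and the property decidable, so the prime may be found by refuting its
-- absence.
... | yes (p , p≤t , pp , large) = p , pp , s≤s⁻¹ p≤t , large
... | no none with root 2 (30 * (t / 30))
...   | u , u²≤ , <s² = contradiction (gap-bound n u 1≤n <s² gap)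
  (growth-contradiction base (1176 + primorialSlack) u n 2≤base (proj₁ big) u²≤ (proj₁ (proj₂ big)) (proj₂ (proj₂ big)))
  where
  open ≤-Reasoning
  n = t / 30
  t<30+30n : t < 30 + 30 * n
  t<30+30n = begin-strict
    t ≡⟨ m≡m%n+[m/n]*n t 30 ⟩
    t % 30 + n * 30 <⟨ +-monoˡ-< (n * 30) (m%n<n t 30) ⟩
    30 + n * 30 ≡⟨ cong (30 +_) (*-comm n 30) ⟩
    30 + 30 * n ∎
  1≤n : 1 ≤ n
  1≤n = m≥n⇒m/n>0 (≤-trans (m≤m+n 30 (v * v)) T≤t)
  -- The start 30 + v² allows for rounding t down to 30n: t < 30 + (u + 1)², so u + 1 ≤ v is
  -- impossible.
  v≤u : v ≤ u
  v≤u = s≤s⁻¹ (≰⇒> λ s≤v → <-irrefl refl (begin-strict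
    30 + v * v ≤⟨ T≤t ⟩
    t <⟨ t<30+30n ⟩
    30 + 30 * n ≤⟨ +-monoʳ-≤ 30 (<⇒≤ <s²) ⟩
    30 + suc u ^ 2 ≡⟨ cong (λ x → 30 + suc u * x) (*-identityʳ (suc u)) ⟩
    30 + suc u * suc u ≤⟨ +-monoʳ-≤ 30 (*-mono-≤ s≤v s≤v) ⟩
    30 + v * v ∎))
  big = threshold u v≤u
  gap : ∀ p → Prime p → p ≤ 30 * n → p ≤ 24 * suc n
  gap p pp p≤30n = <⇒≤ (*-cancelˡ-< 5 _ _ (begin-strict
    5 * p <⟨ ≰⇒> (λ large → none (p , s≤s (≤-trans p≤30n 30n≤t) , pp , large)) ⟩
    4 * suc t ≤⟨ *-monoʳ-≤ 4 t<30+30n ⟩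
    4 * (30 + 30 * n) ≡⟨ e n ⟩
    5 * (24 * suc n) ∎))
    where
    30n≤t : 30 * n ≤ t
    30n≤t = subst (_≤ t) (*-comm n 30) (m/n*n≤m t 30)
    e : ∀ n → 4 * (30 + 30 * n) ≡ 5 * (24 * suc n)
    e = solve-∀

abstract
  prime-between : ∃[ T ] (∀ t → T ≤ t → ∃[ p ] (Prime p × p ≤ t × 4 * suc t ≤ 5 * p))
  prime-between = above (prime-threshold (16 * boundExponent) (4 * (1176 + primorialSlack)) {{exponent≢0}})
    where
    exponent≢0 : NonZero (16 * boundExponent)
    exponent≢0 = subst (λ b → NonZero (16 * b)) (Eq.sym boundExponent≡) _
    above : ∃[ v ] Threshold (16 * boundExponent) (4 * (1176 + primorialSlack)) v →
      ∃[ T ] (∀ t → T ≤ t → ∃[ p ] (Prime p × p ≤ t × 4 * suc t ≤ 5 * p))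
    above (v , threshold) = 30 + v * v , prime-above v threshold

-- Graphs with a partition

-- Only consecutive distinctness is recorded: it is all the algebra needs, and it makes the notion shift invariant.
record ClosedWalk {V : Set} (Adj : V → V → Set) (ℓ : ℕ) : Set where
  field
    walk : ℕ → V
    step : ∀ i → Adj (walk i) (walk (suc i))
    periodic : ∀ i → walk (ℓ + i) ≡ walk i
    nonBacktracking : ∀ i → walk i ≢ walk (2 + i)
open ClosedWalk

-- A partitioned C_ℓ-free graph; |V_i| ≤ κ i is expressed by numbering V_i injectively with slots below κ i.
record Piece (ℓ : ℕ) (κ : ℕ → ℕ) (E : ℕ → ℕ → Set) : Set₁ where
  field
    V : Set
    _~_ : V → V → Set
    ~-sym : ∀ {v w} → v ~ w → w ~ v
    ~-irrefl : ∀ {v} → ¬ v ~ v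
    part slot : V → ℕ
    slot< : ∀ v → slot v < κ (part v)
    distinct : ∀ v w → part v ≡ part w → slot v ≡ slot w → v ≡ w
    joined : ∀ i j → E i j → ∃[ v ] ∃[ w ] (part v ≡ i × part w ≡ j × v ~ w)
    free : ¬ ClosedWalk _~_ ℓ
open Piece

weaken : ∀ {ℓ κ κ′ E E′} → (∀ i → κ i ≤ κ′ i) → (∀ i j → E′ i j → E i j) → Piece ℓ κ E → Piece ℓ κ′ E′
weaken κ≤ E⊆ X = record
  { V = V X ; _~_ = _~_ X ; ~-sym = ~-sym X ; ~-irrefl = ~-irrefl X ; part = part X ; slot = slot X
  ; slot< = λ v → <-≤-trans (slot< X v) (κ≤ _) ; distinct = distinct X
  ; joined = λ i j e → joined X i j (E⊆ i j e) ; free = free X }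

-- For i < s the truncated i ∸ s is 0; the indicator keeps these parts from inheriting the room of
-- part 0.
shift : ∀ {ℓ κ E} s → Piece ℓ κ E →
  Piece ℓ (λ i → κ (i ∸ s) * indicator (s ≤? i)) (λ i j → ∃[ i′ ] ∃[ j′ ] (i ≡ s + i′ × j ≡ s + j′ × E i′ j′))
shift {κ = κ} s X = record
  { V = V X ; _~_ = _~_ X ; ~-sym = ~-sym X ; ~-irrefl = ~-irrefl X
  ; part = λ v → s + part X v ; slot = slot X
  ; slot< = λ v → <-≤-trans (slot< X v) (≤-reflexive (Eq.sym (trans
      (cong₂ _*_ (cong κ (m+n∸m≡n s (part X v))) (indicator-yes (s ≤? s + part X v) (m≤m+n s (part X v))))
      (*-identityʳ _))))
  ; distinct = λ v w eq → distinct X v w (+-cancelˡ-≡ s _ _ eq)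
  ; joined = λ { _ _ (i , j , refl , refl , e) → let v , w , pv , pw , vw = joined X i j e in
      v , w , cong (s +_) pv , cong (s +_) pw , vw }
  ; free = free X }

module _ {ℓ κ₁ κ₂ E₁ E₂} (X : Piece ℓ κ₁ E₁) (Y : Piece ℓ κ₂ E₂) where
  private
    data SumAdj : V X ⊎ V Y → V X ⊎ V Y → Set where
      left : ∀ {v w} → _~_ X v w → SumAdj (inj₁ v) (inj₁ w)
      right : ∀ {v w} → _~_ Y v w → SumAdj (inj₂ v) (inj₂ w)

    sumPart sumSlot : V X ⊎ V Y → ℕ
    sumPart (inj₁ v) = part X v
    sumPart (inj₂ v) = part Y v
    sumSlot (inj₁ v) = slot X v
    sumSlot (inj₂ v) = κ₁ (part Y v) + slot Y v

    slots-disjoint : ∀ v w → part X v ≡ part Y w → slot X v ≢ κ₁ (part Y w) + slot Y w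
    slots-disjoint v w eq eq′ = <⇒≱ (slot< X v)
      (subst (λ i → κ₁ i ≤ slot X v) (Eq.sym eq) (subst (κ₁ (part Y w) ≤_) (Eq.sym eq′) (m≤m+n _ _)))

    sum-distinct : ∀ v w → sumPart v ≡ sumPart w → sumSlot v ≡ sumSlot w → v ≡ w
    sum-distinct (inj₁ v) (inj₁ w) p s = cong inj₁ (distinct X v w p s)
    sum-distinct (inj₁ v) (inj₂ w) p s = ⊥-elim (slots-disjoint v w p s)
    sum-distinct (inj₂ v) (inj₁ w) p s = ⊥-elim (slots-disjoint w v (Eq.sym p) (Eq.sym s))
    sum-distinct (inj₂ v) (inj₂ w) p s = cong inj₂ (distinct Y v w p (+-cancelˡ-≡ (κ₁ (part Y w)) _ _
      (subst (λ i → κ₁ i + slot Y v ≡ κ₁ (part Y w) + slot Y w) p s)))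

    sum-slot< : ∀ v → sumSlot v < κ₁ (sumPart v) + κ₂ (sumPart v)
    sum-slot< (inj₁ v) = <-≤-trans (slot< X v) (m≤m+n _ _)
    sum-slot< (inj₂ v) = +-monoʳ-< _ (slot< Y v)

    stays-left : ∀ {v w} → SumAdj v w → ∃[ v′ ] (v ≡ inj₁ v′) → ∃[ w′ ] (w ≡ inj₁ w′)
    stays-left (left _) _ = _ , refl
    stays-left (right _) (_ , ())

    stays-right : ∀ {v w} → SumAdj v w → ∃[ v′ ] (v ≡ inj₂ v′) → ∃[ w′ ] (w ≡ inj₂ w′)
    stays-right (right _) _ = _ , refl
    stays-right (left _) (_ , ())

    left⁻ : ∀ {v w v′ w′} → v ≡ inj₁ v′ → w ≡ inj₁ w′ → SumAdj v w → _~_ X v′ w′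
    left⁻ refl refl (left vw) = vw

    right⁻ : ∀ {v w v′ w′} → v ≡ inj₂ v′ → w ≡ inj₂ w′ → SumAdj v w → _~_ Y v′ w′
    right⁻ refl refl (right vw) = vw

    sum-free : ¬ ClosedWalk SumAdj ℓ
    sum-free c with walk c 0 in eq₀
    ... | inj₁ v₀ = free X record
      { walk = λ i → proj₁ (at i)
      ; step = λ i → left⁻ (proj₂ (at i)) (proj₂ (at (suc i))) (step c i)
      ; periodic = λ i → inj₁-injective (trans (Eq.sym (proj₂ (at (ℓ + i)))) (trans (periodic c i) (proj₂ (at i))))
      ; nonBacktracking = λ i eq → nonBacktracking c i
          (trans (proj₂ (at i)) (trans (cong inj₁ eq) (Eq.sym (proj₂ (at (2 + i)))))) }
      where
      at : ∀ i → ∃[ v ] (walk c i ≡ inj₁ v)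
      at zero = v₀ , eq₀
      at (suc i) = stays-left (step c i) (at i)
    ... | inj₂ v₀ = free Y record
      { walk = λ i → proj₁ (at i)
      ; step = λ i → right⁻ (proj₂ (at i)) (proj₂ (at (suc i))) (step c i)
      ; periodic = λ i → inj₂-injective (trans (Eq.sym (proj₂ (at (ℓ + i)))) (trans (periodic c i) (proj₂ (at i))))
      ; nonBacktracking = λ i eq → nonBacktracking c i
          (trans (proj₂ (at i)) (trans (cong inj₂ eq) (Eq.sym (proj₂ (at (2 + i)))))) }
      where
      at : ∀ i → ∃[ v ] (walk c i ≡ inj₂ v)
      at zero = v₀ , eq₀
      at (suc i) = stays-right (step c i) (at i)

    sum-joined : ∀ i j → E₁ i j ⊎ E₂ i j → ∃[ v ] ∃[ w ] (sumPart v ≡ i × sumPart w ≡ j × SumAdj v w)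
    sum-joined i j (inj₁ e) = let v , w , pv , pw , vw = joined X i j e in inj₁ v , inj₁ w , pv , pw , left vw
    sum-joined i j (inj₂ e) = let v , w , pv , pw , vw = joined Y i j e in inj₂ v , inj₂ w , pv , pw , right vw

  infixr 5 _⊞_
  -- The vertex sets are made disjoint but parts with the same number are merged, so capacities and
  -- joined pairs add up. The slots of Y start after the room of X, and a closed walk cannot leave
  -- its summand.
  _⊞_ : Piece ℓ (λ i → κ₁ i + κ₂ i) (λ i j → E₁ i j ⊎ E₂ i j)
  _⊞_ = record
    { V = V X ⊎ V Y ; _~_ = SumAdj
    ; ~-sym = λ { (left vw) → left (~-sym X vw) ; (right vw) → right (~-sym Y vw) }
    ; ~-irrefl = λ { (left vv) → ~-irrefl X vv ; (right vv) → ~-irrefl Y vv }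
    ; part = sumPart ; slot = sumSlot ; slot< = sum-slot< ; distinct = sum-distinct
    ; joined = sum-joined ; free = sum-free }

restrict : ∀ {ℓ κ E} r → Piece ℓ κ E →
  Piece ℓ (λ i → κ i * indicator (i <? r)) (λ i j → E i j × i < r × j < r)
restrict {κ = κ} r X = record
  { V = Σ (V X) λ v → part X v < r
  ; _~_ = λ v w → _~_ X (proj₁ v) (proj₁ w)
  ; ~-sym = ~-sym X
  ; ~-irrefl = ~-irrefl X
  ; part = λ v → part X (proj₁ v)
  ; slot = λ v → slot X (proj₁ v)
  ; slot< = λ (v , v<r) → subst (slot X v <_)
      (Eq.sym (trans (cong (κ (part X v) *_) (indicator-yes (part X v <? r) v<r)) (*-identityʳ _))) (slot< X v)
  ; distinct = λ { (v , v<r) (w , w<r) p s → lemma (distinct X v w p s) v<r w<r }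
  ; joined = λ { i j (e , i<r , j<r) → let v , w , pv , pw , vw = joined X i j e in
      (v , subst (_< r) (Eq.sym pv) i<r) , (w , subst (_< r) (Eq.sym pw) j<r) , pv , pw , vw }
  ; free = λ c → free X record
      { walk = λ i → proj₁ (walk c i)
      ; step = step c
      ; periodic = λ i → cong proj₁ (periodic c i)
      ; nonBacktracking = λ i eq → nonBacktracking c i (lemma eq _ _) } }
  where
  lemma : ∀ {v w} → v ≡ w → (p : part X v < r) (q : part X w < r) → (v , p) ≡ (w , q)
  lemma refl p q = cong (_ ,_) (<-irrelevant p q)

-- The parts are numbered from 0; the parts from r on are empty.
RKPiece : ℕ → ℕ → ℕ → Set₁
RKPiece ℓ r k = Piece ℓ (λ i → k * indicator (i <? r)) (λ i j → i < j × j < r)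

-- From pieces to finite graphs

lookup-injective : ∀ {A : Set} {xs : List A} → Unique xs → ∀ i j → lookup xs i ≡ lookup xs j → i ≡ j
lookup-injective (px ∷ u) fzero fzero eq = refl
lookup-injective {xs = x ∷ xs} (px ∷ u) fzero (fsuc j) eq = ⊥-elim (All.lookup px (∈-lookup {xs = xs} j) eq)
lookup-injective {xs = x ∷ xs} (px ∷ u) (fsuc i) fzero eq = ⊥-elim (All.lookup px (∈-lookup {xs = xs} i) (Eq.sym eq))
lookup-injective (px ∷ u) (fsuc i) (fsuc j) eq = cong fsuc (lookup-injective u i j eq)

partSize-quotient : ∀ r k (i : Fin r) → partSize {r * k} (quotient k) i ≤ k
partSize-quotient r k i = Fin.injective⇒≤ {f = λ a → proj₂ (remQuot {r} k (lookup xs a))} λ {a} {b} eq →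
  lookup-injective (filter⁺ _ (allFin⁺ (r * k))) a b (remQuot-injective _ _
    (cong₂ _,_ (trans (quot a) (Eq.sym (quot b))) eq))
  where
  xs = filter (λ v → quotient k v ≟ᶠ i) (allFin (r * k))
  quot : ∀ a → quotient {r} k (lookup xs a) ≡ i
  quot a = All.lookup (all-filter (λ v → quotient k v ≟ᶠ i) (allFin (r * k))) (∈-lookup {xs = xs} a)
  remQuot-injective : ∀ v w → remQuot {r} k v ≡ remQuot {r} k w → v ≡ w
  remQuot-injective v w eq = trans (Eq.sym (Fin.combine-remQuot {r} k v))
    (trans (cong (λ p → combine (proj₁ p) (proj₂ p)) eq) (Fin.combine-remQuot {r} k w))

suc-mod : ∀ i m .{{_ : NonZero m}} → (suc (i % m) < m × suc i % m ≡ suc (i % m)) ⊎ (suc (i % m) ≡ m × suc i % m ≡ 0)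
suc-mod i m with m≤n⇒m<n∨m≡n (m%n<n i m)
... | inj₁ lt = inj₁ (lt , trans reduce (m<n⇒m%n≡m lt))
  where
  reduce : suc i % m ≡ suc (i % m) % m
  reduce = trans (cong (λ x → suc x % m) (m≡m%n+[m/n]*n i m)) ([m+kn]%n≡m%n (suc (i % m)) (i / m) m)
... | inj₂ eq = inj₂ (eq , trans reduce (trans (cong (_% m) eq) (n%n≡0 m)))
  where
  reduce : suc i % m ≡ suc (i % m) % m
  reduce = trans (cong (λ x → suc x % m) (m≡m%n+[m/n]*n i m)) ([m+kn]%n≡m%n (suc (i % m)) (i / m) m)

2+-mod : ∀ i m .{{_ : NonZero m}} → 3 ≤ m → i % m ≢ (2 + i) % m
2+-mod i m 3≤m eq with suc-mod i m | suc-mod (suc i) m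
... | inj₁ (_ , e₁) | inj₁ (_ , e₂) = m≢1+m+n _ (trans eq (trans e₂ (trans (cong suc e₁) (cong suc (Eq.sym (+-comm _ 1))))))
... | inj₁ (_ , e₁) | inj₂ (e , e₂) = <⇒≢ 3≤m
  (trans (cong (2 +_) (Eq.sym (trans eq e₂))) (trans (cong suc (Eq.sym e₁)) e))
... | inj₂ (e , e₁) | inj₁ (_ , e₂) = <⇒≢ 3≤m (trans (cong suc (Eq.sym (trans eq (trans e₂ (cong suc e₁))))) e)
... | inj₂ (e , e₁) | inj₂ (e′ , e₂) = <⇒≢ (<-trans (n<1+n 1) 3≤m) (trans (cong suc (Eq.sym e₁)) e′)

-- The length is at least 3, so i and i + 2 are different positions on the cycle and injectivity
-- excludes backtracking.
cycle⇒closedWalk : ∀ {n} (G : Graph n) m → 2 ≤ m → ContainsCycle G (suc m) → ClosedWalk (Adj G) (suc m)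
cycle⇒closedWalk G m 2≤m (c , inj , path , closing) = record
  { walk = λ i → c (i mod suc m)
  ; step = step′
  ; periodic = λ i → cong c (Fin.toℕ-injective (trans (toℕ-mod (suc m + i))
      (trans (trans (cong (_% suc m) (+-comm (suc m) i)) ([m+n]%n≡m%n i (suc m))) (Eq.sym (toℕ-mod i)))))
  ; nonBacktracking = λ i eq → 2+-mod i (suc m) (s≤s 2≤m)
      (trans (Eq.sym (toℕ-mod i)) (trans (cong toℕ (inj eq)) (toℕ-mod (2 + i)))) }
  where
  toℕ-mod : ∀ i → toℕ (i mod suc m) ≡ i % suc m
  toℕ-mod i = Fin.toℕ-fromℕ< (m%n<n i (suc m))
  step′ : ∀ i → Adj G (c (i mod suc m)) (c (suc i mod suc m))
  step′ i with suc-mod i (suc m)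
  ... | inj₁ (_ , eq) = path _ _ (trans (cong suc (toℕ-mod i)) (trans (Eq.sym eq) (Eq.sym (toℕ-mod (suc i)))))
  ... | inj₂ (e , eq) = subst₂ (λ x y → Adj G (c x) (c y))
    (Fin.toℕ-injective (trans (Fin.toℕ-fromℕ m) (trans (Eq.sym (suc-injective e)) (Eq.sym (toℕ-mod i)))))
    (Fin.toℕ-injective (trans (Eq.sym eq) (Eq.sym (toℕ-mod (suc i)))))
    closing

module _ {m r k : ℕ} (2≤m : 2 ≤ m) (X : RKPiece (suc m) r k) where
  private
    -- A vertex is coded by its part and slot. It need not be decidable whether a code is taken, so
    -- adjacency of codes asserts the existence of vertices behind them; codes without a vertex are
    -- isolated.
    data Codes (v : V X) (x : Fin (r * k)) : Set where
      codes : toℕ (proj₁ (remQuot {r} k x)) ≡ part X v → toℕ (proj₂ (remQuot {r} k x)) ≡ slot X v → Codes v x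

    codes-injective : ∀ {v w x} → Codes v x → Codes w x → v ≡ w
    codes-injective (codes p s) (codes p′ s′) =
      distinct X _ _ (trans (Eq.sym p) p′) (trans (Eq.sym s) s′)

    codes-functional : ∀ {v x y} → Codes v x → Codes v y → x ≡ y
    codes-functional {x = x} {y} (codes p s) (codes p′ s′) = trans (Eq.sym (Fin.combine-remQuot {r} k x))
      (trans (cong₂ combine (Fin.toℕ-injective (trans p (Eq.sym p′))) (Fin.toℕ-injective (trans s (Eq.sym s′))))
        (Fin.combine-remQuot {r} k y))

    encode : ∀ v (i : Fin r) → part X v ≡ toℕ i → Σ (Fin (r * k)) λ x → Codes v x × quotient k x ≡ i
    encode v i eq = x , codes (trans (cong (toℕ ∘ proj₁) rq) (Eq.sym eq))
        (trans (cong (toℕ ∘ proj₂) rq) (Fin.toℕ-fromℕ< slot<k)) , cong proj₁ rq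
      where
      slot<k : slot X v < k
      slot<k = <-≤-trans (slot< X v) (≤-trans (*-monoʳ-≤ k (indicator≤1 (part X v <? r))) (≤-reflexive (*-identityʳ k)))
      x = combine i (fromℕ< slot<k)
      rq = Fin.remQuot-combine i (fromℕ< slot<k)

    G : Graph (r * k)
    G = record
      { Adj = λ x y → ∃[ v ] ∃[ w ] (Codes v x × Codes w y × _~_ X v w)
      ; sym = λ (v , w , vx , wy , vw) → w , v , wy , vx , ~-sym X vw
      ; irrefl = λ (v , w , vx , wx , vw) → ~-irrefl X (subst (_~_ X v) (codes-injective wx vx) vw) }

    edge : ∀ (i j : Fin r) → toℕ i < toℕ j →
      ∃[ x ] ∃[ y ] (quotient k x ≡ i × quotient k y ≡ j × Adj G x y)
    edge i j i<j = x , y , qx , qy , v , w , vx , wy , vw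
      where
      vw-data = joined X (toℕ i) (toℕ j) (i<j , Fin.toℕ<n j)
      v = proj₁ vw-data
      w = proj₁ (proj₂ vw-data)
      vw = proj₂ (proj₂ (proj₂ (proj₂ vw-data)))
      x-data = encode v i (proj₁ (proj₂ (proj₂ vw-data)))
      y-data = encode w j (proj₁ (proj₂ (proj₂ (proj₂ vw-data))))
      x = proj₁ x-data
      y = proj₁ y-data
      vx = proj₁ (proj₂ x-data)
      wy = proj₁ (proj₂ y-data)
      qx = proj₂ (proj₂ x-data)
      qy = proj₂ (proj₂ y-data)

    decode : ClosedWalk (Adj G) (suc m) → ClosedWalk (_~_ X) (suc m)
    decode c = record
      { walk = vertex
      ; step = λ i → subst (_~_ X (vertex i)) (codes-injective (target-codes i) (vertex-codes (suc i)))
          (proj₂ (proj₂ (proj₂ (proj₂ (step c i)))))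
      ; periodic = λ i → codes-injective (subst (Codes (vertex (suc m + i))) (periodic c i) (vertex-codes (suc m + i)))
          (vertex-codes i)
      ; nonBacktracking = λ i eq → nonBacktracking c i
          (codes-functional (vertex-codes i) (subst (λ v → Codes v (walk c (2 + i))) (Eq.sym eq) (vertex-codes (2 + i)))) }
      where
      vertex : ℕ → V X
      vertex i = proj₁ (step c i)
      vertex-codes : ∀ i → Codes (vertex i) (walk c i)
      vertex-codes i = proj₁ (proj₂ (proj₂ (step c i)))
      target-codes : ∀ i → Codes (proj₁ (proj₂ (step c i))) (walk c (suc i))
      target-codes i = proj₁ (proj₂ (proj₂ (proj₂ (step c i))))

  piece⇒graph : ExistsFreeRK (suc m) r k
  piece⇒graph = r * k , G , (quotient k , partSize-quotient r k , connected) ,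
    λ c → free X (decode (cycle⇒closedWalk G m 2≤m c))
    where
    connected : ∀ i j → i ≢ j → ∃[ x ] ∃[ y ] (quotient k x ≡ i × quotient k y ≡ j × Adj G x y)
    connected i j i≢j with <-cmp (toℕ i) (toℕ j)
    ... | tri< i<j _ _ = edge i j i<j
    ... | tri≈ _ i≡j _ = ⊥-elim (i≢j (Fin.toℕ-injective i≡j))
    ... | tri> _ _ j<i = let y , x , qy , qx , yx = edge j i j<i in x , y , qx , qy , sym G yx

-- Wenger graphs

infix 4 _∣ᶻ_
_∣ᶻ_ : ℕ → ℤ → Set
q ∣ᶻ z = ⁺ q ℤ.∣ z

sumℤ : (ℕ → ℤ) → ℕ → ℤ
sumℤ f zero = 0ℤ
sumℤ f (suc n) = sumℤ f n ℤ.+ f n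

sumℤ-cong : ∀ {f g} n → (∀ i → f i ≡ g i) → sumℤ f n ≡ sumℤ g n
sumℤ-cong zero eq = refl
sumℤ-cong (suc n) eq = cong₂ ℤ._+_ (sumℤ-cong n eq) (eq n)

sumℤ-∣ : ∀ {q f} n → (∀ i → q ∣ᶻ f i) → q ∣ᶻ sumℤ f n
sumℤ-∣ {q} zero d = ℤ.divides 0ℤ (Eq.sym (ℤ.*-zeroˡ (⁺ q)))
sumℤ-∣ (suc n) d = ℤ.∣m∣n⇒∣m+n (sumℤ-∣ n d) (d n)

sumℤ-telescope : ∀ (f : ℕ → ℤ) n → sumℤ (λ i → f (suc i) ℤ.- f i) n ≡ f n ℤ.- f 0
sumℤ-telescope f zero = Eq.sym (ℤ.+-inverseʳ (f 0))
sumℤ-telescope f (suc n) = trans (cong (ℤ._+ (f (suc n) ℤ.- f n)) (sumℤ-telescope f n))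
  (lemma (f (suc n)) (f n) (f 0))
  where
  lemma : ∀ a b c → (b ℤ.- c) ℤ.+ (a ℤ.- b) ≡ a ℤ.- c
  lemma = ℤSolver.solve-∀

sumℤ-linear : ∀ f g y n → sumℤ (λ i → f i ℤ.- y ℤ.* g i) n ≡ sumℤ f n ℤ.- y ℤ.* sumℤ g n
sumℤ-linear f g y zero = lemma y
  where
  lemma : ∀ y → 0ℤ ≡ 0ℤ ℤ.- y ℤ.* 0ℤ
  lemma = ℤSolver.solve-∀
sumℤ-linear f g y (suc n) = trans (cong (ℤ._+ (f n ℤ.- y ℤ.* g n)) (sumℤ-linear f g y n))
  (lemma (sumℤ f n) (sumℤ g n) (f n) (g n) y)
  where
  lemma : ∀ a b c d y → (a ℤ.- y ℤ.* b) ℤ.+ (c ℤ.- y ℤ.* d) ≡ (a ℤ.+ c) ℤ.- y ℤ.* (b ℤ.+ d)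
  lemma = ℤSolver.solve-∀

sumℤ-head : ∀ {f} n → (∀ i → 0 < i → i ≤ n → f i ≡ 0ℤ) → sumℤ f (suc n) ≡ f 0
sumℤ-head {f} zero eq = ℤ.+-identityˡ (f 0)
sumℤ-head {f} (suc n) eq = trans (cong₂ ℤ._+_ (sumℤ-head n λ i 0<i i≤n → eq i 0<i (m≤n⇒m≤1+n i≤n)) (eq (suc n) (s≤s z≤n) ≤-refl))
  (ℤ.+-identityʳ (f 0))

euclid : ∀ {q} x y → Prime q → q ∣ᶻ x ℤ.* y → q ∣ᶻ x ⊎ q ∣ᶻ y
euclid {q} x y pq d with euclidsLemma ℤ.∣ x ∣ ℤ.∣ y ∣ pq (subst (q ℕ.∣_) (ℤ.abs-* x y) (ℤ.∣⇒∣ᵤ d))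
... | inj₁ d′ = inj₁ (ℤ.∣ᵤ⇒∣ d′)
... | inj₂ d′ = inj₂ (ℤ.∣ᵤ⇒∣ d′)

moment : (w x : ℕ → ℤ) → ℕ → ℕ → ℤ
moment w x m n = sumℤ (λ j → w j ℤ.* x j ℤ.^ n) m

module _ (s x : ℕ → ℤ) where
  -- s j ∏_{1 ≤ l ≤ k} (x j - x l)
  reduced : ℕ → ℕ → ℤ
  reduced zero j = s j
  reduced (suc k) j = reduced k j ℤ.* (x j ℤ.- x (suc k))

  reduced-moment : ∀ k m n → moment (reduced (suc k)) x m n ≡
    moment (reduced k) x m (suc n) ℤ.- x (suc k) ℤ.* moment (reduced k) x m n
  reduced-moment k m n = trans (sumℤ-cong m λ j → lemma (reduced k j) (x j) (x (suc k)) (x j ℤ.^ n))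
    (sumℤ-linear _ _ (x (suc k)) m)
    where
    lemma : ∀ w x y p → w ℤ.* (x ℤ.- y) ℤ.* p ≡ w ℤ.* (x ℤ.* p) ℤ.- y ℤ.* (w ℤ.* p)
    lemma = ℤSolver.solve-∀

  -- Multiplying the weights by x j - x (k + 1) combines the moments of orders n + 1 and n, so each
  -- eliminated node uses up one order.
  reduced-∣ : ∀ {q} m N k → (∀ n → n ≤ N + k → q ∣ᶻ moment s x m n) →
    ∀ n → n ≤ N → q ∣ᶻ moment (reduced k) x m n
  reduced-∣ m N zero d n n≤N = d n (m≤n⇒m≤n+o 0 n≤N)
  reduced-∣ {q} m N (suc k) d n n≤N = subst (q ∣ᶻ_) (Eq.sym (reduced-moment k m n))
    (ℤ.∣m∣n⇒∣m-n (IH (suc n) (s≤s n≤N)) (ℤ.∣n⇒∣m*n (x (suc k)) (IH n (m≤n⇒m≤1+n n≤N))))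
    where
    IH = reduced-∣ m (suc N) k (λ n n≤ → d n (subst (n ≤_) (Eq.sym (+-suc N k)) n≤))

  reduced-zero : ∀ k j → 0 < j → j ≤ k → reduced k j ≡ 0ℤ
  reduced-zero zero j 0<j j≤0 = contradiction j≤0 (<⇒≱ 0<j)
  reduced-zero (suc k) j 0<j j≤ with m≤n⇒m<n∨m≡n j≤
  ... | inj₁ j<k+1 = trans (cong (ℤ._* (x j ℤ.- x (suc k))) (reduced-zero k j 0<j (s≤s⁻¹ j<k+1))) (ℤ.*-zeroˡ (x j ℤ.- x (suc k)))
  ... | inj₂ refl = trans (cong (reduced k j ℤ.*_) (ℤ.+-inverseʳ (x j))) (ℤ.*-zeroʳ (reduced k j))

  reduced-prime : ∀ {q} k → Prime q → q ∣ᶻ reduced k 0 → q ∣ᶻ s 0 ⊎ ∃[ l ] (0 < l × l ≤ k × q ∣ᶻ x 0 ℤ.- x l)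
  reduced-prime zero pq d = inj₁ d
  reduced-prime (suc k) pq d with euclid (reduced k 0) (x 0 ℤ.- x (suc k)) pq d
  ... | inj₂ d′ = inj₂ (suc k , s≤s z≤n , ≤-refl , d′)
  ... | inj₁ d′ with reduced-prime k pq d′
  ...   | inj₁ d″ = inj₁ d″
  ...   | inj₂ (l , 0<l , l≤k , d″) = inj₂ (l , 0<l , m≤n⇒m≤1+n l≤k , d″)

  -- Vandermonde modulo q: eliminating the nodes 1, …, k one after the other leaves only the node 0.
  moments-vanish : ∀ {q} k → Prime q → (∀ n → n ≤ k → q ∣ᶻ moment s x (suc k) n) →
    q ∣ᶻ s 0 ⊎ ∃[ l ] (0 < l × l ≤ k × q ∣ᶻ x 0 ℤ.- x l)
  moments-vanish {q} k pq d = reduced-prime k pq (subst (q ∣ᶻ_) only-head (reduced-∣ (suc k) 0 k d 0 z≤n))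
    where
    only-head : moment (reduced k) x (suc k) 0 ≡ reduced k 0
    only-head = trans (sumℤ-head k λ j 0<j j≤k → trans (cong (ℤ._* 1ℤ) (reduced-zero k j 0<j j≤k)) (ℤ.*-zeroˡ 1ℤ))
      (ℤ.*-identityʳ (reduced k 0))

∣-difference : ∀ {q a b} → a < q → b < q → q ∣ᶻ ⁺ a ℤ.- ⁺ b → a ≡ b
∣-difference {q} {a} {b} a<q b<q d = ℤ.+-injective (ℤ.i-j≡0⇒i≡j (⁺ a) (⁺ b) (ℤ.∣i∣≡0⇒i≡0 (small _ ∣a-b∣<q (ℤ.∣⇒∣ᵤ d))))
  where
  small : ∀ n → n < q → q ℕ.∣ n → n ≡ 0
  small zero _ _ = refl
  small (suc n) n<q d = contradiction (ℕ.∣⇒≤ d) (<⇒≱ n<q)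
  ∣a-b∣<q : ℤ.∣ ⁺ a ℤ.- ⁺ b ∣ < q
  ∣a-b∣<q = subst (λ z → ℤ.∣ z ∣ < q) (Eq.sym (ℤ.m-n≡m⊖n a b))
    (≤-<-trans (ℤ.∣m⊝n∣≤m⊔n a b) (⊔-lub a<q b<q))

residue : ∀ q .{{_ : NonZero q}} z → ∃[ r ] (q ∣ᶻ ⁺ toℕ {q} r ℤ.- z)
residue q z = fromℕ< (ℤ.n%ℕd<d z q) , ℤ.divides (ℤ.- (z ℤ./ℕ q)) (begin
  ⁺ toℕ (fromℕ< (ℤ.n%ℕd<d z q)) ℤ.- z ≡⟨ cong (λ r → ⁺ r ℤ.- z) (Fin.toℕ-fromℕ< (ℤ.n%ℕd<d z q)) ⟩
  r ℤ.- z ≡⟨ cong (λ y → r ℤ.- y) (ℤ.a≡a%ℕn+[a/ℕn]*n z q) ⟩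
  r ℤ.- (r ℤ.+ z ℤ./ℕ q ℤ.* ⁺ q) ≡⟨ lemma r (z ℤ./ℕ q) (⁺ q) ⟩
  ℤ.- (z ℤ./ℕ q) ℤ.* ⁺ q ∎)
  where
  open ≡-Reasoning
  r = ⁺ (z ℤ.%ℕ q)
  lemma : ∀ r a b → r ℤ.- (r ℤ.+ a ℤ.* b) ≡ ℤ.- a ℤ.* b
  lemma = ℤSolver.solve-∀

-- Here x i stands for the direction of the i-th line of a closed walk through m lines.
NoPairing : ℕ → Set
NoPairing m = ∀ (x : ℕ → ℕ) → (∀ i → x (m + i) ≡ x i) → (∀ i → x i ≢ x (suc i)) →
  ¬ (∀ i → ∃[ l ] (0 < l × l < m × x i ≡ x (l + i)))

noPairing-3 : NoPairing 3
noPairing-3 x periodic x≢ pairing with pairing 0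
... | 1 , _ , _ , eq = x≢ 0 eq
... | 2 , _ , _ , eq = x≢ 2 (trans (Eq.sym eq) (Eq.sym (periodic 0)))
... | suc (suc (suc _)) , _ , s≤s (s≤s (s≤s ())) , _

-- Pairs at distance 2 or 3 are the edges of a 5-cycle; a pairing would be a perfect matching of it.
noPairing-5 : NoPairing 5
noPairing-5 x periodic x≢ pairing = no-matching (near 0) (near 1)
    (Sum.map₂ (λ e → trans e (periodic 0)) (near 2))
    (Sum.map (λ e → trans e (periodic 0)) (λ e → trans e (periodic 1)) (near 3))
    (Sum.map (λ e → trans e (periodic 1)) (λ e → trans e (periodic 2)) (near 4))
  where
  near : ∀ i → x i ≡ x (2 + i) ⊎ x i ≡ x (3 + i)
  near i with pairing i
  ... | 1 , _ , _ , eq = ⊥-elim (x≢ i eq)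
  ... | 2 , _ , _ , eq = inj₁ eq
  ... | 3 , _ , _ , eq = inj₂ eq
  ... | 4 , _ , _ , eq = ⊥-elim (x≢ (4 + i) (trans (Eq.sym eq) (Eq.sym (periodic i))))
  ... | suc (suc (suc (suc (suc _)))) , _ , s≤s (s≤s (s≤s (s≤s (s≤s ())))) , _
  no-matching : x 0 ≡ x 2 ⊎ x 0 ≡ x 3 → x 1 ≡ x 3 ⊎ x 1 ≡ x 4 → x 2 ≡ x 4 ⊎ x 2 ≡ x 0 →
    x 3 ≡ x 0 ⊎ x 3 ≡ x 1 → x 4 ≡ x 1 ⊎ x 4 ≡ x 2 → ⊥
  no-matching (inj₁ e02) _ _ (inj₁ e30) (inj₁ e41) = x≢ 2 (Eq.sym (trans e30 e02))
  no-matching (inj₁ e02) _ _ (inj₂ e31) (inj₁ e41) = x≢ 3 (trans e31 (Eq.sym e41))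
  no-matching (inj₁ e02) _ _ _ (inj₂ e42) = x≢ 4 (trans e42 (trans (Eq.sym e02) (Eq.sym (periodic 0))))
  no-matching (inj₂ e03) (inj₁ e13) (inj₁ e24) _ _ = x≢ 0 (trans e03 (Eq.sym e13))
  no-matching (inj₂ e03) (inj₂ e14) (inj₁ e24) _ _ = x≢ 1 (trans e14 (Eq.sym e24))
  no-matching (inj₂ e03) _ (inj₂ e20) _ _ = x≢ 2 (trans e20 e03)

funToFin-cong : ∀ {m n} {f g : Fin m → Fin n} → (∀ i → f i ≡ g i) → funToFin f ≡ funToFin g
funToFin-cong {zero} eq = refl
funToFin-cong {suc m} eq = cong₂ combine (eq fzero) (funToFin-cong λ i → eq (fsuc i))

finToFun-injective : ∀ {m n} (i j : Fin (n ^ m)) → (∀ a → finToFun {n} {m} i a ≡ finToFun j a) → i ≡ j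
finToFun-injective {m} {n} i j eq = trans (Eq.sym (Fin.funToFin-finToFin {m} {n} i))
  (trans (funToFin-cong eq) (Fin.funToFin-finToFin {m} {n} j))

-- Wenger's graph: points p and lines l with 2h + 1 coordinates over the field of q elements, incident when
-- p_d + l_d = p₀ x^d for all d, where l₀ = 0 and x, the direction of l, is an extra coordinate.
-- The part of a point consists of p₀, …, p_h and its slot of the other coordinates;
-- the part of a line consists of x, l_{h+1}, …, l_{2h} and its slot of l₁, …, l_h.
module Wenger (q h : ℕ) (q-prime : Prime q) (noPairing : NoPairing (suc (h + h))) where
  private
    instance
      q≢0 : NonZero q
      q≢0 = prime⇒nonZero q-prime

    m Q k : ℕ
    m = suc (h + h)
    Q = q ^ suc h
    k = q ^ h

    Point Line Index : Set
    Point = Fin Q × Fin k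
    Line = Fin Q × Fin k
    Index = Fin (suc h) ⊎ Fin h

    -- Exponent 0 gives the vacuous condition p₀ + 0 = p₀. It is kept as a coordinate because its
    -- telescoping sum supplies the moment of order 0.
    exponent : Index → ℕ
    exponent (inj₁ i) = toℕ i
    exponent (inj₂ i) = suc h + toℕ i

    digit : ∀ n → Fin (q ^ n) → Fin n → ℕ
    digit n u i = toℕ (finToFun {q} {n} u i)

    digits-injective : ∀ n (u v : Fin (q ^ n)) → (∀ i → digit n u i ≡ digit n v i) → u ≡ v
    digits-injective n u v eq = finToFun-injective {n} {q} u v λ i → Fin.toℕ-injective (eq i)

    digit< : ∀ n u i → digit n u i < q
    digit< n u i = Fin.toℕ<n (finToFun {q} {n} u i)

    pointCoord lineCoord : Fin Q × Fin k → Index → ℕ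
    pointCoord (P , U) (inj₁ i) = digit (suc h) P i
    pointCoord (P , U) (inj₂ i) = digit h U i
    lineCoord (J , W) (inj₁ fzero) = 0
    lineCoord (J , W) (inj₁ (fsuc i)) = digit h W i
    lineCoord (J , W) (inj₂ i) = digit (suc h) J (fsuc i)

    first : Fin Q × Fin k → ℕ
    first (P , U) = digit (suc h) P fzero

    pointCoord< : ∀ p d → pointCoord p d < q
    pointCoord< (P , U) (inj₁ i) = digit< (suc h) P i
    pointCoord< (P , U) (inj₂ i) = digit< h U i

    lineCoord< : ∀ l d → lineCoord l d < q
    lineCoord< l (inj₁ fzero) = >-nonZero⁻¹ q
    lineCoord< (J , W) (inj₁ (fsuc i)) = digit< h W i
    lineCoord< (J , W) (inj₂ i) = digit< (suc h) J (fsuc i)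

    defect : Point → Line → Index → ℤ
    defect p l d = ⁺ pointCoord p d ℤ.+ ⁺ lineCoord l d ℤ.- ⁺ first p ℤ.* (⁺ first l) ℤ.^ exponent d

    Incident : Point → Line → Set
    Incident p l = ∀ d → q ∣ᶻ defect p l d

    -- Subtracting the incidence conditions gives p′_d - p_d ≡ (p′₀ - p₀) x^d. A vanishing weight in
    -- the Vandermonde argument thus means that the walk has stood still.
    point-unique : ∀ {p p′ l} → Incident p l → Incident p′ l → q ∣ᶻ ⁺ first p′ ℤ.- ⁺ first p → p′ ≡ p
    point-unique {p@(P , U)} {p′@(P′ , U′)} {l} inc inc′ first≡ = cong₂ _,_
      (digits-injective (suc h) P′ P (λ i → coord≡ (inj₁ i))) (digits-injective h U′ U (λ i → coord≡ (inj₂ i)))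
      where
      lemma : ∀ p p′ l a a′ y → (p′ ℤ.+ l ℤ.- a′ ℤ.* y) ℤ.- (p ℤ.+ l ℤ.- a ℤ.* y) ℤ.+ y ℤ.* (a′ ℤ.- a) ≡ p′ ℤ.- p
      lemma = ℤSolver.solve-∀
      coord≡ : ∀ d → pointCoord p′ d ≡ pointCoord p d
      coord≡ d = ∣-difference (pointCoord< p′ d) (pointCoord< p d) (subst (q ∣ᶻ_)
        (lemma (⁺ pointCoord p d) (⁺ pointCoord p′ d) (⁺ lineCoord l d) (⁺ first p) (⁺ first p′) ((⁺ first l) ℤ.^ exponent d))
        (ℤ.∣m∣n⇒∣m+n (ℤ.∣m∣n⇒∣m-n (inc′ d) (inc d)) (ℤ.∣n⇒∣m*n ((⁺ first l) ℤ.^ exponent d) first≡)))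

    line-unique : ∀ {p l l′} → Incident p l → Incident p l′ → first l ≡ first l′ → l ≡ l′
    line-unique {p} {l@(J , W)} {l′@(J′ , W′)} inc inc′ first≡ = cong₂ _,_
      (digits-injective (suc h) J J′ λ { fzero → first≡ ; (fsuc i) → coord≡ (inj₂ i) })
      (digits-injective h W W′ λ i → coord≡ (inj₁ (fsuc i)))
      where
      lemma : ∀ p l l′ a → (p ℤ.+ l ℤ.- a) ℤ.- (p ℤ.+ l′ ℤ.- a) ≡ l ℤ.- l′
      lemma = ℤSolver.solve-∀
      coord≡ : ∀ d → lineCoord l d ≡ lineCoord l′ d
      coord≡ d = ∣-difference (lineCoord< l d) (lineCoord< l′ d) (subst (q ∣ᶻ_)
        (lemma (⁺ pointCoord p d) (⁺ lineCoord l d) (⁺ lineCoord l′ d) (⁺ first p ℤ.* (⁺ first l) ℤ.^ exponent d))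
        (ℤ.∣m∣n⇒∣m-n (inc d) (subst (λ x → q ∣ᶻ ⁺ pointCoord p d ℤ.+ ⁺ lineCoord l′ d ℤ.- ⁺ first p ℤ.* (⁺ x) ℤ.^ exponent d)
          (Eq.sym first≡) (inc′ d))))

    exponent-surjective : ∀ n → n ≤ h + h → ∃[ d ] (exponent d ≡ n)
    exponent-surjective n n≤ with n <? suc h
    ... | yes n< = inj₁ (fromℕ< n<) , Fin.toℕ-fromℕ< n<
    ... | no n≮ = inj₂ (fromℕ< n∸<) , trans (cong (suc h +_) (Fin.toℕ-fromℕ< n∸<)) (m+[n∸m]≡n (≮⇒≥ n≮))
      where
      n∸< : n ∸ suc h < h
      n∸< = +-cancelˡ-< (suc h) _ _ (subst (_< suc h + h) (Eq.sym (m+[n∸m]≡n (≮⇒≥ n≮))) (s≤s n≤))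

    -- Two points p, p′ of a line of direction x differ by (p′₀ - p₀) (1, x, …, x^{2h}).
    no-polygon : (p : ℕ → Point) (l : ℕ → Line) → (∀ i → Incident (p i) (l i)) → (∀ i → Incident (p (suc i)) (l i)) →
      (∀ i → p (m + i) ≡ p i) → (∀ i → l (m + i) ≡ l i) → (∀ i → p i ≢ p (suc i)) → (∀ i → l i ≢ l (suc i)) → ⊥
    no-polygon p l inc inc′ p-periodic l-periodic p≢ l≢ = noPairing x (λ i → cong first (l-periodic i))
        (λ i eq → l≢ i (line-unique (inc′ i) (inc (suc i)) eq)) pairing
      where
      x : ℕ → ℕ
      x i = first (l i)
      module _ (i : ℕ) where
        s y : ℕ → ℤ
        s j = ⁺ first (p (suc j + i)) ℤ.- ⁺ first (p (j + i))
        y j = ⁺ x (j + i)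
        coord : Index → ℕ → ℤ
        coord d j = ⁺ pointCoord (p (j + i)) d
        step-divides : ∀ d j → q ∣ᶻ (coord d (suc j) ℤ.- coord d j) ℤ.- 1ℤ ℤ.* (s j ℤ.* y j ℤ.^ exponent d)
        step-divides d j = subst (q ∣ᶻ_)
          (lemma (coord d (suc j)) (coord d j) (⁺ lineCoord (l (j + i)) d)
            (⁺ first (p (suc j + i))) (⁺ first (p (j + i))) (y j ℤ.^ exponent d))
          (ℤ.∣m∣n⇒∣m-n (inc′ (j + i) d) (inc (j + i) d))
          where
          lemma : ∀ p′ p l a′ a z → (p′ ℤ.+ l ℤ.- a′ ℤ.* z) ℤ.- (p ℤ.+ l ℤ.- a ℤ.* z) ≡
            (p′ ℤ.- p) ℤ.- 1ℤ ℤ.* ((a′ ℤ.- a) ℤ.* z)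
          lemma = ℤSolver.solve-∀
        moments : ∀ n → n ≤ h + h → q ∣ᶻ moment s y m n
        moments n n≤ with exponent-surjective n n≤
        ... | d , refl = subst (q ∣ᶻ_) (begin
            0ℤ ℤ.- sumℤ (λ j → (coord d (suc j) ℤ.- coord d j) ℤ.- 1ℤ ℤ.* (s j ℤ.* y j ℤ.^ exponent d)) m
              ≡⟨ cong (λ z → 0ℤ ℤ.- z) (sumℤ-linear (λ j → coord d (suc j) ℤ.- coord d j) (λ j → s j ℤ.* y j ℤ.^ exponent d) 1ℤ m) ⟩
            0ℤ ℤ.- (sumℤ (λ j → coord d (suc j) ℤ.- coord d j) m ℤ.- 1ℤ ℤ.* M)
              ≡⟨ cong (λ z → 0ℤ ℤ.- (z ℤ.- 1ℤ ℤ.* M)) closes ⟩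
            0ℤ ℤ.- (0ℤ ℤ.- 1ℤ ℤ.* M) ≡⟨ lemma M ⟩
            M ∎)
          (ℤ.∣m∣n⇒∣m-n (ℤ.divides 0ℤ (Eq.sym (ℤ.*-zeroˡ (⁺ q)))) (sumℤ-∣ m (step-divides d)))
          where
          open ≡-Reasoning
          M = moment s y m (exponent d)
          closes : sumℤ (λ j → coord d (suc j) ℤ.- coord d j) m ≡ 0ℤ
          closes = trans (sumℤ-telescope (coord d) m)
            (ℤ.i≡j⇒i-j≡0 (cong (λ v → ⁺ pointCoord v d) (p-periodic i)))
          lemma : ∀ z → 0ℤ ℤ.- (0ℤ ℤ.- 1ℤ ℤ.* z) ≡ z
          lemma = ℤSolver.solve-∀
      pairing : ∀ i → ∃[ j ] (0 < j × j < m × x i ≡ x (j + i))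
      -- The elimination isolates node 0 only; reading the walk from position i makes this the i-th
      -- line.
      pairing i with moments-vanish (s i) (y i) (h + h) q-prime (moments i)
      ... | inj₁ d = ⊥-elim (p≢ i (Eq.sym (point-unique (inc i) (inc′ i) d)))
      ... | inj₂ (j , 0<j , j≤ , d) = j , 0<j , s≤s j≤ ,
        ∣-difference (lineFirst< (l i)) (lineFirst< (l (j + i))) d
        where
        lineFirst< : ∀ v → first v < q
        lineFirst< (J , W) = digit< (suc h) J fzero

    data Adjacent : Point ⊎ Line → Point ⊎ Line → Set where
      point-line : ∀ {p l} → Incident p l → Adjacent (inj₁ p) (inj₂ l)
      line-point : ∀ {p l} → Incident p l → Adjacent (inj₂ l) (inj₁ p)

    from-point : ∀ {v w} → Adjacent v w → ∃[ p ] (v ≡ inj₁ p) → ∃[ l ] (w ≡ inj₂ l)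
    from-point (point-line _) _ = _ , refl
    from-point (line-point _) (_ , ())

    from-line : ∀ {v w} → Adjacent v w → ∃[ l ] (v ≡ inj₂ l) → ∃[ p ] (w ≡ inj₁ p)
    from-line (line-point _) _ = _ , refl
    from-line (point-line _) (_ , ())

    incident₁ : ∀ {v w p l} → v ≡ inj₁ p → w ≡ inj₂ l → Adjacent v w → Incident p l
    incident₁ refl refl (point-line inc) = inc

    incident₂ : ∀ {v w p l} → v ≡ inj₂ l → w ≡ inj₁ p → Adjacent v w → Incident p l
    incident₂ refl refl (line-point inc) = inc

    no-walk-from-point : (c : ClosedWalk Adjacent (2 * m)) → ∀ p → walk c 0 ≢ inj₁ p
    no-walk-from-point c p₀ eq₀ = no-polygon p l
        (λ i → incident₁ (even≡ i) (odd≡ i) (step c (i * 2)))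
        (λ i → incident₂ (odd≡ i) (even≡ (suc i)) (step c (suc (i * 2))))
        (λ i → inj₁-injective (trans (Eq.sym (even≡ (m + i))) (trans (period i) (even≡ i))))
        (λ i → inj₂-injective (trans (Eq.sym (odd≡ (m + i))) (trans (period′ i) (odd≡ i))))
        (λ i eq → nonBacktracking c (i * 2) (trans (even≡ i) (trans (cong inj₁ eq) (Eq.sym (even≡ (suc i))))))
        (λ i eq → nonBacktracking c (suc (i * 2)) (trans (odd≡ i) (trans (cong inj₂ eq) (Eq.sym (odd≡ (suc i))))))
      where
      even : ∀ i → ∃[ p ] (walk c (i * 2) ≡ inj₁ p)
      odd : ∀ i → ∃[ l ] (walk c (suc (i * 2)) ≡ inj₂ l)
      even zero = p₀ , eq₀
      even (suc i) = from-line (step c (suc (i * 2))) (odd i)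
      odd i = from-point (step c (i * 2)) (even i)
      p : ℕ → Point
      p i = proj₁ (even i)
      l : ℕ → Line
      l i = proj₁ (odd i)
      even≡ : ∀ i → walk c (i * 2) ≡ inj₁ (p i)
      even≡ i = proj₂ (even i)
      odd≡ : ∀ i → walk c (suc (i * 2)) ≡ inj₂ (l i)
      odd≡ i = proj₂ (odd i)
      index : ∀ i → (m + i) * 2 ≡ 2 * m + i * 2
      index i = trans (*-distribʳ-+ 2 m i) (cong (_+ i * 2) (*-comm m 2))
      period : ∀ i → walk c ((m + i) * 2) ≡ walk c (i * 2)
      period i = trans (cong (walk c) (index i)) (periodic c (i * 2))
      period′ : ∀ i → walk c (suc ((m + i) * 2)) ≡ walk c (suc (i * 2))
      period′ i = trans (cong (walk c) (trans (cong suc (index i)) (Eq.sym (+-suc (2 * m) (i * 2)))))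
        (periodic c (suc (i * 2)))

    rotate : ∀ {V : Set} {_~_ : V → V → Set} {n} → ClosedWalk _~_ n → ClosedWalk _~_ n
    rotate {n = n} c = record
      { walk = λ i → walk c (suc i)
      ; step = λ i → step c (suc i)
      ; periodic = λ i → trans (cong (walk c) (Eq.sym (+-suc n i))) (periodic c (suc i))
      ; nonBacktracking = λ i → nonBacktracking c (suc i) }

    no-walk : ¬ ClosedWalk Adjacent (2 * m)
    no-walk c with walk c 0 in eq₀
    ... | inj₁ p = no-walk-from-point c p eq₀
    ... | inj₂ l = let p , eq₁ = from-line (step c 0) (l , eq₀) in no-walk-from-point (rotate c) p eq₁

    -- Every nontrivial incidence condition contains exactly one coordinate left free by the two
    -- parts, with coefficient 1: l_d for 1 ≤ d ≤ h and p_d for h < d ≤ 2h. This is what makes the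
    -- choices of fixed coordinates complementary.
    line-through : ∀ P J → ∃[ U ] ∃[ W ] Incident (P , U) (J , W)
    line-through P J = U , W , incident
      where
      target : Index → ℤ
      target d = ⁺ digit (suc h) P fzero ℤ.* (⁺ digit (suc h) J fzero) ℤ.^ exponent d
      w : ∀ (i : Fin h) → ∃[ r ] (q ∣ᶻ ⁺ toℕ {q} r ℤ.- (target (inj₁ (fsuc i)) ℤ.- ⁺ digit (suc h) P (fsuc i)))
      w i = residue q (target (inj₁ (fsuc i)) ℤ.- ⁺ digit (suc h) P (fsuc i))
      u : ∀ (i : Fin h) → ∃[ r ] (q ∣ᶻ ⁺ toℕ {q} r ℤ.- (target (inj₂ i) ℤ.- ⁺ digit (suc h) J (fsuc i)))
      u i = residue q (target (inj₂ i) ℤ.- ⁺ digit (suc h) J (fsuc i))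
      W U : Fin k
      W = funToFin (λ i → proj₁ (w i))
      U = funToFin (λ i → proj₁ (u i))
      digit-W : ∀ i → digit h W i ≡ toℕ (proj₁ (w i))
      digit-W i = cong toℕ (Fin.finToFun-funToFin (λ i → proj₁ (w i)) i)
      digit-U : ∀ i → digit h U i ≡ toℕ (proj₁ (u i))
      digit-U i = cong toℕ (Fin.finToFun-funToFin (λ i → proj₁ (u i)) i)
      e₀ : ∀ a → 0ℤ ≡ a ℤ.+ 0ℤ ℤ.- a ℤ.* 1ℤ
      e₀ = ℤSolver.solve-∀
      e₁ : ∀ w t p → w ℤ.- (t ℤ.- p) ≡ p ℤ.+ w ℤ.- t
      e₁ = ℤSolver.solve-∀
      e₂ : ∀ u t j → u ℤ.- (t ℤ.- j) ≡ u ℤ.+ j ℤ.- t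
      e₂ = ℤSolver.solve-∀
      incident : Incident (P , U) (J , W)
      incident (inj₁ fzero) = subst (q ∣ᶻ_) (e₀ (⁺ digit (suc h) P fzero)) (ℤ.divides 0ℤ (Eq.sym (ℤ.*-zeroˡ (⁺ q))))
      incident (inj₁ (fsuc i)) = subst (q ∣ᶻ_)
        (trans (cong (λ x → ⁺ x ℤ.- (target (inj₁ (fsuc i)) ℤ.- ⁺ digit (suc h) P (fsuc i))) (Eq.sym (digit-W i)))
          (e₁ (⁺ digit h W i) (target (inj₁ (fsuc i))) (⁺ digit (suc h) P (fsuc i))))
        (proj₂ (w i))
      incident (inj₂ i) = subst (q ∣ᶻ_)
        (trans (cong (λ x → ⁺ x ℤ.- (target (inj₂ i) ℤ.- ⁺ digit (suc h) J (fsuc i))) (Eq.sym (digit-U i)))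
          (e₂ (⁺ digit h U i) (target (inj₂ i)) (⁺ digit (suc h) J (fsuc i))))
        (proj₂ (u i))

  -- The point parts are numbered from 0 and the line parts from s.
  block : ∀ s → Piece (2 * suc (h + h)) (λ i → q ^ h * indicator (i <? q ^ suc h) + q ^ h * indicator (s ≤? i))
    (λ i j → i < q ^ suc h × ∃[ j′ ] (j ≡ s + j′ × j′ < q ^ suc h))
  block s = record
    { V = Point ⊎ Line ; _~_ = Adjacent
    ; ~-sym = λ { (point-line inc) → line-point inc ; (line-point inc) → point-line inc }
    ; ~-irrefl = λ ()
    ; part = part′ ; slot = slot′ ; slot< = slot′< ; distinct = distinct′
    ; joined = joined′ ; free = no-walk }
    where
    part′ slot′ : Point ⊎ Line → ℕ
    part′ (inj₁ (P , U)) = toℕ P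
    part′ (inj₂ (J , W)) = s + toℕ J
    slot′ (inj₁ (P , U)) = toℕ U
    slot′ (inj₂ (J , W)) = k * indicator (s + toℕ J <? Q) + toℕ W
    point-size : ∀ (P : Fin Q) {i} → toℕ P ≡ i → k * indicator (i <? Q) ≡ k
    point-size P refl = trans (cong (k *_) (indicator-yes (toℕ P <? Q) (Fin.toℕ<n P))) (*-identityʳ k)
    line-size : ∀ (J : Fin Q) → k * indicator (s ≤? s + toℕ J) ≡ k
    line-size J = trans (cong (k *_) (indicator-yes (s ≤? s + toℕ J) (m≤m+n s (toℕ J)))) (*-identityʳ k)
    slot′< : ∀ v → slot′ v < k * indicator (part′ v <? Q) + k * indicator (s ≤? part′ v)
    slot′< (inj₁ (P , U)) = <-≤-trans (Fin.toℕ<n U) (≤-trans (≤-reflexive (Eq.sym (point-size P refl))) (m≤m+n _ _))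
    slot′< (inj₂ (J , W)) = +-monoʳ-< _ (<-≤-trans (Fin.toℕ<n W) (≤-reflexive (Eq.sym (line-size J))))
    separate : ∀ (p : Point) (l : Line) → part′ (inj₁ p) ≡ part′ (inj₂ l) → slot′ (inj₁ p) ≢ slot′ (inj₂ l)
    separate (P , U) (J , W) same eq = <⇒≱ (Fin.toℕ<n U)
      (≤-trans (≤-reflexive (Eq.sym (point-size P same))) (subst (k * indicator (s + toℕ J <? Q) ≤_) (Eq.sym eq) (m≤m+n _ _)))
    distinct′ : ∀ v w → part′ v ≡ part′ w → slot′ v ≡ slot′ w → v ≡ w
    distinct′ (inj₁ (P , U)) (inj₁ (P′ , U′)) ep es = cong inj₁ (cong₂ _,_ (Fin.toℕ-injective ep) (Fin.toℕ-injective es))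
    distinct′ (inj₁ p) (inj₂ l) ep es = ⊥-elim (separate p l ep es)
    distinct′ (inj₂ l) (inj₁ p) ep es = ⊥-elim (separate p l (Eq.sym ep) (Eq.sym es))
    distinct′ (inj₂ (J , W)) (inj₂ (J′ , W′)) ep es with Fin.toℕ-injective (+-cancelˡ-≡ s _ _ ep)
    ... | refl = cong (λ W → inj₂ (J , W)) (Fin.toℕ-injective (+-cancelˡ-≡ (k * indicator (s + toℕ J <? Q)) _ _ es))
    joined′ : ∀ i j → i < Q × ∃[ j′ ] (j ≡ s + j′ × j′ < Q) →
      ∃[ v ] ∃[ w ] (part′ v ≡ i × part′ w ≡ j × Adjacent v w)
    joined′ i _ (i<Q , j′ , refl , j′<Q) = let U , W , inc = line-through (fromℕ< i<Q) (fromℕ< j′<Q) in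
      inj₁ (fromℕ< i<Q , U) , inj₂ (fromℕ< j′<Q , W) , Fin.toℕ-fromℕ< i<Q , cong (s +_) (Fin.toℕ-fromℕ< j′<Q) , point-line inc

-- The recursion

^-cancelʳ-≤ : ∀ d .{{_ : NonZero d}} {x y} → x ^ d ≤ y ^ d → x ≤ y
^-cancelʳ-≤ d le = ≮⇒≥ λ y<x → <⇒≱ (^-monoˡ-< d y<x) le

emptyPiece : ∀ {ℓ} → RKPiece ℓ 0 0
emptyPiece = record
  { V = ⊥ ; _~_ = λ _ _ → ⊥ ; ~-sym = λ () ; ~-irrefl = λ () ; part = λ () ; slot = λ ()
  ; slot< = λ () ; distinct = λ () ; joined = λ { _ _ (_ , ()) } ; free = λ c → ClosedWalk.walk c 0 }

module _ (h : ℕ) (noPairing : NoPairing (suc (h + h))) where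
  private
    d ℓ : ℕ
    d = suc h
    ℓ = 2 * suc (h + h)

  -- The parts below x and those from q^d on lack a point or a line part, which makes room for a copy of X.
  extend : ∀ {q x k} r K → Prime q → x ≤ q ^ d → r ≤ q ^ d + x → 2 * q ^ h ≤ K → q ^ h + k ≤ K →
    RKPiece ℓ x k → RKPiece ℓ r K
  extend {q} {x} {k} r K q-prime x≤Q r≤ 2q≤K qk≤K X =
    weaken (λ i → *-monoˡ-≤ (indicator (i <? r)) (size i))
      (λ i j (i<j , j<r) → cover i j i<j j<r , <-trans i<j j<r , j<r)
      (restrict r (Wenger.block q h q-prime noPairing x ⊞ (X ⊞ shift (q ^ d) X)))
    where
    open ≤-Reasoning
    Q = q ^ d
    a = q ^ h
    E : ℕ → ℕ → Set
    E i j = i < j × j < x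
    cover : ∀ i j → i < j → j < r → (i < Q × ∃[ j′ ] (j ≡ x + j′ × j′ < Q)) ⊎
      (E i j ⊎ ∃[ i′ ] ∃[ j′ ] (i ≡ Q + i′ × j ≡ Q + j′ × E i′ j′))
    -- The block joins i < Q to j ≥ x. Of the remaining pairs, those with i < Q have j < x and lie
    -- in the first copy of X; those with i ≥ Q lie in the shifted copy.
    cover i j i<j j<r with i <? Q | x ≤? j
    ... | yes i<Q | yes x≤j = inj₁ (i<Q , j ∸ x , Eq.sym (m+[n∸m]≡n x≤j) ,
      +-cancelˡ-< x _ _ (subst (_< x + Q) (Eq.sym (m+[n∸m]≡n x≤j)) (subst (j <_) (+-comm Q x) (<-≤-trans j<r r≤))))
    ... | yes _ | no x≰j = inj₂ (inj₁ (i<j , ≰⇒> x≰j))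
    ... | no i≮Q | _ = inj₂ (inj₂ (i ∸ Q , j ∸ Q , Eq.sym (m+[n∸m]≡n Q≤i) , Eq.sym (m+[n∸m]≡n Q≤j) ,
        ∸-monoˡ-< i<j Q≤i , +-cancelˡ-< Q _ _ (subst (_< Q + x) (Eq.sym (m+[n∸m]≡n Q≤j)) (<-≤-trans j<r r≤))))
      where
      Q≤i = ≮⇒≥ i≮Q
      Q≤j = ≤-trans Q≤i (<⇒≤ i<j)
    *-≤ : ∀ n {e} → e ≤ 1 → n * e ≤ n
    *-≤ n e≤1 = ≤-trans (*-monoʳ-≤ n e≤1) (≤-reflexive (*-identityʳ n))
    *-≡0 : ∀ n {e} → e ≡ 0 → n * e ≡ 0
    *-≡0 n refl = *-zeroʳ n
    size : ∀ i → (a * indicator (i <? Q) + a * indicator (x ≤? i)) +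
      (k * indicator (i <? x) + k * indicator (i ∸ Q <? x) * indicator (Q ≤? i)) ≤ K
    -- The contents are points and X for i < x, points and lines for x ≤ i < Q, lines and the
    -- shifted X for i ≥ Q. Since x ≤ Q, no part receives three shares.
    size i with i <? x
    ... | yes i<x = begin
      (a * indicator (i <? Q) + a * indicator (x ≤? i)) + (k * 1 + k * indicator (i ∸ Q <? x) * indicator (Q ≤? i))
        ≡⟨ cong₂ (λ y z → (a * indicator (i <? Q) + y) + (k * 1 + z))
             (*-≡0 a (indicator-no (x ≤? i) (<⇒≱ i<x)))
             (*-≡0 (k * indicator (i ∸ Q <? x)) (indicator-no (Q ≤? i) (<⇒≱ (<-≤-trans i<x x≤Q)))) ⟩
      (a * indicator (i <? Q) + 0) + (k * 1 + 0)
        ≤⟨ +-mono-≤ (≤-trans (≤-reflexive (+-identityʳ _)) (*-≤ a (indicator≤1 (i <? Q))))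
             (≤-reflexive (trans (+-identityʳ _) (*-identityʳ k))) ⟩
      a + k ≤⟨ qk≤K ⟩
      K ∎
    ... | no i≮x with i <? Q
    ...   | yes i<Q = begin
      (a * 1 + a * indicator (x ≤? i)) + (k * 0 + k * indicator (i ∸ Q <? x) * indicator (Q ≤? i))
        ≡⟨ cong₂ (λ y z → (a * 1 + a * indicator (x ≤? i)) + (y + z)) (*-zeroʳ k)
             (*-≡0 (k * indicator (i ∸ Q <? x)) (indicator-no (Q ≤? i) (<⇒≱ i<Q))) ⟩
      (a * 1 + a * indicator (x ≤? i)) + 0
        ≤⟨ ≤-trans (≤-reflexive (+-identityʳ _))
             (+-mono-≤ (≤-reflexive (*-identityʳ a)) (≤-trans (*-≤ a (indicator≤1 (x ≤? i))) (≤-reflexive (Eq.sym (+-identityʳ a))))) ⟩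
      2 * a ≤⟨ 2q≤K ⟩
      K ∎
    ...   | no _ = begin
      (a * 0 + a * indicator (x ≤? i)) + (k * 0 + k * indicator (i ∸ Q <? x) * indicator (Q ≤? i))
        ≡⟨ cong₂ (λ y z → (y + a * indicator (x ≤? i)) + (z + k * indicator (i ∸ Q <? x) * indicator (Q ≤? i)))
             (*-zeroʳ a) (*-zeroʳ k) ⟩
      a * indicator (x ≤? i) + k * indicator (i ∸ Q <? x) * indicator (Q ≤? i)
        ≤⟨ +-mono-≤ (*-≤ a (indicator≤1 (x ≤? i)))
             (≤-trans (*-≤ _ (indicator≤1 (Q ≤? i))) (*-≤ k (indicator≤1 (i ∸ Q <? x)))) ⟩
      a + k ≤⟨ qk≤K ⟩
      K ∎

  -- The bounds 2 r^{h/d} for r and for x = r - q^d are compatible as long as q ≥ (4/5) r^{1/d}.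
  Compatible : Set
  Compatible = ∀ q x → 4 ^ d * (q ^ d + x) ≤ 5 ^ d * q ^ d →
    x ≤ q ^ d × (∀ j → j ^ d ≤ 2 ^ d * x ^ h → (q ^ h + j) ^ d ≤ 2 ^ d * (q ^ d + x) ^ h)

  -- The constant K is split off from the main term j: one step turns j′ + K into max(2 q^h, q^h +
  -- j′) + K, so the error is handed on unchanged and does not accumulate.
  Bounded : ℕ → ℕ → Set₁
  Bounded K r = ∃[ j ] (RKPiece ℓ r (j + K) × j ^ d ≤ 2 ^ d * r ^ h)

  bounded : Compatible → ∃[ K ] (∀ r → Bounded K r)
  bounded compatible = 2 * q₀ ^ h , <-rec _ induct
    where
    open ≤-Reasoning
    t₀ = proj₁ prime-between
    -- The prime from the interval below 2 t₀ satisfies q₀ ≥ t₀. Its block alone has enough parts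
    -- for every r whose root is below t₀, and this base case determines K.
    initial = proj₂ prime-between (2 * t₀) (m≤m+n t₀ (t₀ + 0))
    q₀ = proj₁ initial
    K = 2 * q₀ ^ h
    t₀≤q₀ : t₀ ≤ q₀
    t₀≤q₀ = *-cancelˡ-≤ 5 (begin
      5 * t₀ ≤⟨ m≤m+n (5 * t₀) (3 * t₀ + 4) ⟩
      5 * t₀ + (3 * t₀ + 4) ≡⟨ e t₀ ⟩
      4 * suc (2 * t₀) ≤⟨ proj₂ (proj₂ (proj₂ initial)) ⟩
      5 * q₀ ∎)
      where
      e : ∀ t₀ → 5 * t₀ + (3 * t₀ + 4) ≡ 4 * suc (2 * t₀)
      e = solve-∀
    induct : ∀ r → (∀ {x} → x < r → Bounded K x) → Bounded K r
    induct r rec with root d r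
    ... | t , t^d≤r , r<t+1^d with t₀ ≤? t
    ...   | no t₀≰t = 0 , extend r K (proj₁ (proj₂ initial)) z≤n r≤ ≤-refl q≤2q emptyPiece , z≤n
      where
      r≤ : r ≤ q₀ ^ d + 0
      r≤ = ≤-trans (<⇒≤ r<t+1^d) (≤-trans (^-monoˡ-≤ d (≤-trans (≰⇒> t₀≰t) t₀≤q₀)) (m≤m+n _ 0))
      q≤2q : q₀ ^ h + 0 ≤ K
      q≤2q = +-monoʳ-≤ (q₀ ^ h) z≤n
    ...   | yes t₀≤t with proj₂ prime-between t t₀≤t
    ...     | q , q-prime , q≤t , 4t≤5q = j , piece , j-bound
      where
      Q = q ^ d
      x = r ∸ Q
      Q≤r : Q ≤ r
      Q≤r = ≤-trans (^-monoˡ-≤ d q≤t) t^d≤r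
      Q+x≡r : Q + x ≡ r
      Q+x≡r = m+[n∸m]≡n Q≤r
      1≤Q : 1 ≤ Q
      1≤Q = m^n>0 q {{prime⇒nonZero q-prime}} d
      compat = compatible q x (begin
        4 ^ d * (Q + x) ≡⟨ cong (4 ^ d *_) Q+x≡r ⟩
        4 ^ d * r ≤⟨ *-monoʳ-≤ (4 ^ d) (<⇒≤ r<t+1^d) ⟩
        4 ^ d * suc t ^ d ≡⟨ ^-distribʳ-* 4 (suc t) d ⟨
        (4 * suc t) ^ d ≤⟨ ^-monoˡ-≤ d 4t≤5q ⟩
        (5 * q) ^ d ≡⟨ ^-distribʳ-* 5 q d ⟩
        5 ^ d * Q ∎)
      smaller = rec {x} (∸-monoʳ-< {r} {Q} {0} 1≤Q Q≤r)
      j′ = proj₁ smaller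
      j = 2 * q ^ h ⊔ (q ^ h + j′)
      piece : RKPiece ℓ r (j + K)
      piece = extend r (j + K) q-prime (proj₁ compat) (≤-reflexive (Eq.sym Q+x≡r))
        (≤-trans (m≤m⊔n _ _) (m≤m+n j K))
        (≤-trans (≤-reflexive (Eq.sym (+-assoc (q ^ h) j′ K))) (+-monoˡ-≤ K (m≤n⊔m (2 * q ^ h) _)))
        (proj₁ (proj₂ smaller))
      j-bound : j ^ d ≤ 2 ^ d * r ^ h
      j-bound with ⊔-sel (2 * q ^ h) (q ^ h + j′)
      ... | inj₁ eq = begin
        j ^ d ≡⟨ cong (_^ d) eq ⟩
        (2 * q ^ h) ^ d ≡⟨ ^-distribʳ-* 2 (q ^ h) d ⟩
        2 ^ d * (q ^ h) ^ d ≡⟨ cong (2 ^ d *_) (trans (^-*-assoc q h d) (trans (cong (q ^_) (*-comm h d)) (Eq.sym (^-*-assoc q d h)))) ⟩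
        2 ^ d * Q ^ h ≤⟨ *-monoʳ-≤ (2 ^ d) (^-monoˡ-≤ h Q≤r) ⟩
        2 ^ d * r ^ h ∎
      ... | inj₂ eq = begin
        j ^ d ≡⟨ cong (_^ d) eq ⟩
        (q ^ h + j′) ^ d ≤⟨ proj₂ compat j′ (proj₂ (proj₂ smaller)) ⟩
        2 ^ d * (Q + x) ^ h ≡⟨ cong (λ y → 2 ^ d * y ^ h) Q+x≡r ⟩
        2 ^ d * r ^ h ∎

-- With 9 = 25 - 16 the hypothesis reads √x ≤ (3/4) q, so j ≤ (3/2) q, which is exactly what the
-- square has to spare.
compatible₁ : Compatible 1 noPairing-3
compatible₁ q x 16r≤25q² = x≤q² , bound
  where
  open ≤-Reasoning
  e₁ : ∀ q → 25 * (q * (q * 1)) ≡ 16 * (q * (q * 1)) + 9 * (q * (q * 1))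
  e₁ = solve-∀
  16x≤9q² : 16 * x ≤ 9 * q ^ 2
  16x≤9q² = +-cancelˡ-≤ (16 * q ^ 2) _ _ (begin
    16 * q ^ 2 + 16 * x ≡⟨ *-distribˡ-+ 16 (q ^ 2) x ⟨
    16 * (q ^ 2 + x) ≤⟨ 16r≤25q² ⟩
    25 * q ^ 2 ≡⟨ e₁ q ⟩
    16 * q ^ 2 + 9 * q ^ 2 ∎)
  x≤q² : x ≤ q ^ 2
  x≤q² = *-cancelˡ-≤ 16 (≤-trans 16x≤9q² (*-monoˡ-≤ (q ^ 2) (m≤m+n 9 7)))
  bound : ∀ j → j ^ 2 ≤ 4 * x ^ 1 → (q ^ 1 + j) ^ 2 ≤ 4 * (q ^ 2 + x) ^ 1
  bound j j²≤4x = begin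
    (q ^ 1 + j) ^ 2 ≡⟨ e₂ q j ⟩
    q * q + q * (2 * j) + j ^ 2 ≤⟨ +-mono-≤ (+-monoʳ-≤ (q * q) (*-monoʳ-≤ q 2j≤3q)) j²≤4x ⟩
    q * q + q * (3 * q) + 4 * x ^ 1 ≡⟨ e₃ q x ⟩
    4 * (q ^ 2 + x) ^ 1 ∎
    where
    e₂ : ∀ q j → (q * 1 + j) * ((q * 1 + j) * 1) ≡ q * q + q * (2 * j) + j * (j * 1)
    e₂ = solve-∀
    e₃ : ∀ q x → q * q + q * (3 * q) + 4 * (x * 1) ≡ 4 * ((q * (q * 1) + x) * 1)
    e₃ = solve-∀
    e₄ : ∀ x → 4 * (4 * (x * 1)) ≡ 16 * x
    e₄ = solve-∀
    2j≤3q : 2 * j ≤ 3 * q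
    2j≤3q = ^-cancelʳ-≤ 2 (begin
      (2 * j) ^ 2 ≡⟨ ^-distribʳ-* 2 j 2 ⟩
      4 * j ^ 2 ≤⟨ *-monoʳ-≤ 4 j²≤4x ⟩
      4 * (4 * x ^ 1) ≡⟨ e₄ x ⟩
      16 * x ≤⟨ 16x≤9q² ⟩
      9 * q ^ 2 ≡⟨ ^-distribʳ-* 3 q 2 ⟨
      (3 * q) ^ 2 ∎)

compatible₂ : Compatible 2 noPairing-5
compatible₂ q x 64r≤125q³ = x≤q³ , bound
  where
  open ≤-Reasoning
  e₁ : ∀ q → 125 * (q * (q * (q * 1))) ≡ 64 * (q * (q * (q * 1))) + 61 * (q * (q * (q * 1)))
  e₁ = solve-∀
  x≤q³ : x ≤ q ^ 3
  x≤q³ = *-cancelˡ-≤ 64 (+-cancelˡ-≤ (64 * q ^ 3) _ _ (begin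
    64 * q ^ 3 + 64 * x ≡⟨ *-distribˡ-+ 64 (q ^ 3) x ⟨
    64 * (q ^ 3 + x) ≤⟨ 64r≤125q³ ⟩
    125 * q ^ 3 ≡⟨ e₁ q ⟩
    64 * q ^ 3 + 61 * q ^ 3 ≤⟨ +-monoʳ-≤ (64 * q ^ 3) (*-monoˡ-≤ (q ^ 3) (m≤m+n 61 3)) ⟩
    64 * q ^ 3 + 64 * q ^ 3 ∎))
  bound : ∀ j → j ^ 3 ≤ 8 * x ^ 2 → (q ^ 2 + j) ^ 3 ≤ 8 * (q ^ 3 + x) ^ 2
  bound j j³≤8x² = begin
    -- The additional u j² raises the coefficient 3 to 4, and 4 · 4 q³x is then the cross term of 8
    -- (q³ + x)². Only x ≤ q³ enters, so there is slack.
    (u + j) ^ 3 ≤⟨ m≤m+n _ (u * j ^ 2) ⟩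
    (u + j) ^ 3 + u * j ^ 2 ≡⟨ e₂ u j ⟩
    u ^ 3 + 3 * (u * u) * j + 4 * (u * j ^ 2) + j ^ 3
      ≤⟨ +-mono-≤ (+-mono-≤ (+-monoʳ-≤ (u ^ 3) (*-monoʳ-≤ (3 * (u * u)) j≤2u)) (*-monoʳ-≤ 4 uj²≤4q³x)) j³≤8x² ⟩
    u ^ 3 + 3 * (u * u) * (2 * u) + 4 * (4 * (q ^ 3 * x)) + 8 * x ^ 2 ≤⟨ m≤m+n _ (u ^ 3) ⟩
    u ^ 3 + 3 * (u * u) * (2 * u) + 4 * (4 * (q ^ 3 * x)) + 8 * x ^ 2 + u ^ 3 ≡⟨ e₃ q x ⟩
    8 * (q ^ 3 + x) ^ 2 ∎
    where
    u = q ^ 2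
    e₂ : ∀ u j → (u + j) * ((u + j) * ((u + j) * 1)) + u * (j * (j * 1)) ≡
      u * (u * (u * 1)) + 3 * (u * u) * j + 4 * (u * (j * (j * 1))) + j * (j * (j * 1))
    e₂ = solve-∀
    e₃ : ∀ q x → let u = q * (q * 1) in
      u * (u * (u * 1)) + 3 * (u * u) * (2 * u) + 4 * (4 * (q * (q * (q * 1)) * x)) + 8 * (x * (x * 1))
        + u * (u * (u * 1)) ≡ 8 * ((q * (q * (q * 1)) + x) * ((q * (q * (q * 1)) + x) * 1))
    e₃ = solve-∀
    e₄ : ∀ q → 8 * (q * (q * (q * 1)) * (q * (q * (q * 1)) * 1)) ≡
      2 * (q * (q * 1)) * (2 * (q * (q * 1)) * (2 * (q * (q * 1)) * 1))
    e₄ = solve-∀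
    e₅ : ∀ u j → u * (j * (j * 1)) * (u * (j * (j * 1)) * 1) ≡ u * u * (j * (j * (j * (j * 1))))
    e₅ = solve-∀
    e₆ : ∀ q x → let u = q * (q * 1) in u * u * (2 * u * (8 * (x * (x * 1)))) ≡
      4 * (q * (q * (q * 1)) * x) * (4 * (q * (q * (q * 1)) * x) * 1)
    e₆ = solve-∀
    j≤2u : j ≤ 2 * u
    j≤2u = ^-cancelʳ-≤ 3 (begin
      j ^ 3 ≤⟨ j³≤8x² ⟩
      8 * x ^ 2 ≤⟨ *-monoʳ-≤ 8 (^-monoˡ-≤ 2 x≤q³) ⟩
      8 * (q ^ 3) ^ 2 ≡⟨ e₄ q ⟩
      (2 * u) ^ 3 ∎)
    uj²≤4q³x : u * j ^ 2 ≤ 4 * (q ^ 3 * x)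
    uj²≤4q³x = ^-cancelʳ-≤ 2 (begin
      (u * j ^ 2) ^ 2 ≡⟨ e₅ u j ⟩
      u * u * (j * j ^ 3) ≤⟨ *-monoʳ-≤ (u * u) (*-mono-≤ j≤2u j³≤8x²) ⟩
      u * u * (2 * u * (8 * x ^ 2)) ≡⟨ e₆ q x ⟩
      (4 * (q ^ 3 * x)) ^ 2 ∎)

-- Absorbing the additive constant into the o-term

minkowski₂ : ∀ A s {a b} → a ^ 2 ≤ A ^ 2 * s → b ^ 2 ≤ s → (a + b) ^ 2 ≤ (A + 1) ^ 2 * s
minkowski₂ A s {a} {b} a²≤ b²≤ = begin
  (a + b) ^ 2 ≡⟨ e₁ a b ⟩
  a ^ 2 + 2 * (a * b) + b ^ 2 ≤⟨ +-mono-≤ (+-mono-≤ a²≤ (*-monoʳ-≤ 2 ab≤)) b²≤ ⟩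
  A ^ 2 * s + 2 * (A * s) + s ≡⟨ e₂ A s ⟩
  (A + 1) ^ 2 * s ∎
  where
  open ≤-Reasoning
  e₁ : ∀ a b → (a + b) * ((a + b) * 1) ≡ a * (a * 1) + 2 * (a * b) + b * (b * 1)
  e₁ = solve-∀
  e₂ : ∀ A s → A * (A * 1) * s + 2 * (A * s) + s ≡ (A + 1) * ((A + 1) * 1) * s
  e₂ = solve-∀
  e₃ : ∀ A s → A * (A * 1) * s * s ≡ A * s * (A * s * 1)
  e₃ = solve-∀
  -- The number s stands for the square of a real root; mixed terms are compared after squaring so
  -- that the root itself never occurs.
  ab≤ : a * b ≤ A * s
  ab≤ = ^-cancelʳ-≤ 2 (begin
    (a * b) ^ 2 ≡⟨ ^-distribʳ-* a b 2 ⟩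
    a ^ 2 * b ^ 2 ≤⟨ *-mono-≤ a²≤ b²≤ ⟩
    A ^ 2 * s * s ≡⟨ e₃ A s ⟩
    (A * s) ^ 2 ∎)

minkowski₃ : ∀ A s {a b} → a ^ 3 ≤ A ^ 3 * s → b ^ 3 ≤ s → (a + b) ^ 3 ≤ (A + 1) ^ 3 * s
minkowski₃ A s {a} {b} a³≤ b³≤ = begin
  (a + b) ^ 3 ≡⟨ e₁ a b ⟩
  a ^ 3 + 3 * (a * a * b) + 3 * (a * b * b) + b ^ 3
    ≤⟨ +-mono-≤ (+-mono-≤ (+-mono-≤ a³≤ (*-monoʳ-≤ 3 aab≤)) (*-monoʳ-≤ 3 abb≤)) b³≤ ⟩
  A ^ 3 * s + 3 * (A * A * s) + 3 * (A * s) + s ≡⟨ e₂ A s ⟩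
  (A + 1) ^ 3 * s ∎
  where
  open ≤-Reasoning
  e₁ : ∀ a b → (a + b) * ((a + b) * ((a + b) * 1)) ≡
    a * (a * (a * 1)) + 3 * (a * a * b) + 3 * (a * b * b) + b * (b * (b * 1))
  e₁ = solve-∀
  e₂ : ∀ A s → A * (A * (A * 1)) * s + 3 * (A * A * s) + 3 * (A * s) + s ≡ (A + 1) * ((A + 1) * ((A + 1) * 1)) * s
  e₂ = solve-∀
  e₃ : ∀ A s → A * (A * (A * 1)) * s * (A * (A * (A * 1)) * s) * s ≡ A * A * s * (A * A * s * (A * A * s * 1))
  e₃ = solve-∀
  e₄ : ∀ A s → A * (A * (A * 1)) * s * s * s ≡ A * s * (A * s * (A * s * 1))
  e₄ = solve-∀
  expand : ∀ a b c → (a * b * c) ^ 3 ≡ a ^ 3 * b ^ 3 * c ^ 3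
  expand a b c = trans (^-distribʳ-* (a * b) c 3) (cong (_* c ^ 3) (^-distribʳ-* a b 3))
  aab≤ : a * a * b ≤ A * A * s
  aab≤ = ^-cancelʳ-≤ 3 (begin
    (a * a * b) ^ 3 ≡⟨ expand a a b ⟩
    a ^ 3 * a ^ 3 * b ^ 3 ≤⟨ *-mono-≤ (*-mono-≤ a³≤ a³≤) b³≤ ⟩
    A ^ 3 * s * (A ^ 3 * s) * s ≡⟨ e₃ A s ⟩
    (A * A * s) ^ 3 ∎)
  abb≤ : a * b * b ≤ A * s
  abb≤ = ^-cancelʳ-≤ 3 (begin
    (a * b * b) ^ 3 ≡⟨ expand a b b ⟩
    a ^ 3 * b ^ 3 * b ^ 3 ≤⟨ *-mono-≤ (*-mono-≤ a³≤ b³≤) b³≤ ⟩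
    A ^ 3 * s * s * s ≡⟨ e₄ A s ⟩
    (A * s) ^ 3 ∎)

-- The slack 1/M absorbs the constant K.
absorb-constant : ∀ d → (∀ A s {a b} → a ^ d ≤ A ^ d * s → b ^ d ≤ s → (a + b) ^ d ≤ (A + 1) ^ d * s) →
  ∀ M K j s → j ^ d ≤ 2 ^ d * s → (M * K) ^ d ≤ s → (M * (j + K)) ^ d ≤ (2 * M + 1) ^ d * s
absorb-constant d minkowski M K j s j^d≤ MK^d≤ =
  subst (λ y → y ^ d ≤ (2 * M + 1) ^ d * s) (Eq.sym (*-distribˡ-+ M j K)) (minkowski (2 * M) s (begin
    (M * j) ^ d ≡⟨ ^-distribʳ-* M j d ⟩
    M ^ d * j ^ d ≤⟨ *-monoʳ-≤ (M ^ d) j^d≤ ⟩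
    M ^ d * (2 ^ d * s) ≡⟨ *-assoc (M ^ d) (2 ^ d) s ⟨
    M ^ d * 2 ^ d * s ≡⟨ cong (_* s) (trans (*-comm (M ^ d) (2 ^ d)) (Eq.sym (^-distribʳ-* 2 M d))) ⟩
    (2 * M) ^ d * s ∎) MK^d≤)
  where open ≤-Reasoning

C₆-bound : ∃[ K ] (∀ r → Bounded 1 noPairing-3 K r) →
  (m : ℕ) → ∃[ R ] ((r : ℕ) → R ≤ r →
    ∃[ k ] (ExistsFreeRK 6 r k × (suc m * k) ^ 2 ≤ (2 * suc m + 1) ^ 2 * r))
C₆-bound (K , bound) m = (suc m * K) ^ 2 , λ r R≤r →
  let j , X , j²≤ = bound r in
  j + K , piece⇒graph (s≤s (s≤s z≤n)) X ,
  absorb-constant 2 minkowski₂ (suc m) K j r (subst (λ s → j ^ 2 ≤ 4 * s) (^-identityʳ r) j²≤) R≤r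

C₁₀-bound : ∃[ K ] (∀ r → Bounded 2 noPairing-5 K r) →
  (m : ℕ) → ∃[ R ] ((r : ℕ) → R ≤ r →
    ∃[ k ] (ExistsFreeRK 10 r k × (suc m * k) ^ 3 ≤ (2 * suc m + 1) ^ 3 * r ^ 2))
C₁₀-bound (K , bound) m = (suc m * K) ^ 3 , λ r R≤r →
  let j , X , j³≤ = bound r in
  j + K , piece⇒graph (s≤s (s≤s z≤n)) X ,
  absorb-constant 3 minkowski₃ (suc m) K j (r ^ 2) j³≤ (≤-trans R≤r (r≤r² r))
  where
  r≤r² : ∀ r → r ≤ r ^ 2
  r≤r² zero = z≤n
  r≤r² r@(suc _) = m≤m*n r (r * 1)

theorem1p5 : ((m : ℕ) → ∃[ R ] ((r : ℕ) → R ≤ r →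
    ∃[ k ] (ExistsFreeRK 6 r k × (suc m * k) ^ 2 ≤ (2 * suc m + 1) ^ 2 * r)))
    ×
    ((m : ℕ) → ∃[ R ] ((r : ℕ) → R ≤ r →
    ∃[ k ] (ExistsFreeRK 10 r k × (suc m * k) ^ 3 ≤ (2 * suc m + 1) ^ 3 * r ^ 2)))
theorem1p5 = C₆-bound (bounded 1 noPairing-3 compatible₁) , C₁₀-bound (bounded 2 noPairing-5 compatible₂)
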